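{- For $n\ge0$ let $\tau_{n,k}$ be the number of $\mathbf a\in\mathcal{DP}(n)$ with $\mathrm{twin}(\Gamma_{\mathbf a})=k$, and let $\mathrm{twin}_n(t)=\sum_{\mathbf a\in\mathcal{DP}(n)}t^{\mathrm{twin}(\Gamma_{\mathbf a})}=\sum_{k=0}^n\tau_{n,k}t^k$. Then for each $n\ge0$, $$\tau_{n+1,k}=\binom nkM_{n-k}$$ for all $0\le k\le n+1$, where $M_j$ is the $j$th Motzkin number, from which it follows that the twin statistic is distributed as the triangle OEIS A091869 over all Dyck paths. In particular (for each $n\ge 0$), $$\mathrm{twin}_n(t)=(1+t)^{n-1}\,{}_2F_1\!\left(-\frac{n-1}{2},\frac{2-n}{2};2;\frac{4}{(1+t)^2}\right).$$
   Context: Write $[n]=\{1,\dots,n\}$. An area sequence of size $n$ is a sequence $\mathbf a=(a_1,\dots,a_n)$ of nonnegative integers with $a_i<i$ for all $i$ and $a_i\le a_{i-1}+1$ for all $i\ge 2$; $\mathcal{DP}(n)$ is the set of all of them (they are in bijection with Dyck paths of semilength $n$; for $n=0$ there is only the empty sequence, giving the empty graph). Each $\mathbf a$ defines a graph $\Gamma_{\mathbf a}$ (a unit interval graph) on $[n]$ with edges $\{j,i\}$ for $1\le j<i\le n$ with $i-a_i\le j$. The twin number $\mathrm{twin}(\Gamma_{\mathbf a})$ is the number of pairs $(j,j+1)$ of adjacent vertices with $N(j)\setminus\{j+1\}=N(j+1)\setminus\{j\}$, where $N(i)$ is the set of neighbors of $i$. The Motzkin number $M_k$ is the number of lattice paths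 from $(0,0)$ to $(k,0)$ with steps $(1,1),(1,-1),(1,0)$ never going below the $x$-axis; for $k=n+1$ the right-hand side of the coefficient formula is read as $0$, since $\binom{n}{n+1}=0$. The OEIS triangle A091869 has entries $T(m,k)=\binom{m-1}{k}M_{m-1-k}$. ${}_2F_1$ is the ordinary hypergeometric function.
   Formalization: The hypergeometric formula is proved for n ≥ 1 only; at n = 0 it is false, since twin_0(t) = 1 while the right-hand side at t = 3 equals 2 − √3. -}

module Defs where

open import Level using (0ℓ)
open import Algebra.Bundles using (CommutativeRing)
open import Data.Bool.Properties as Bool using ()
open import Data.Fin.Base using (Fin; toℕ)
open import Data.Fin.Properties using (all?)
open import Data.Fin.Subset using (Subset; _-_)
open import Data.Integer.Base using (+_)
open import Data.List.Base using (List; []; _∷_; length; filter; map; foldr; upTo; allFin; cartesianProduct; cartesianProductWith)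
open import Data.Nat.Base as ℕ using (ℕ; zero; suc; _+_; _*_; _∸_; _≤_; _<_; _≥_; _!)
open import Data.Nat.Combinatorics using (_C_)
open import Data.Nat.Properties as ℕ using (_≟_; _≤?_; _<?_; _!≢0)
open import Data.Product.Base using (_×_; _,_; ∃)
open import Data.Rational.Base as ℚ using (ℚ)
open import Data.Rational.Properties as ℚ using ()
open import Data.Sum.Base using (_⊎_; inj₁; inj₂; swap)
open import Data.Vec.Base using (Vec; []; _∷_; lookup; tabulate)
open import Data.Vec.Properties using (≡-dec)
open import Relation.Binary.Core using (Rel)
open import Relation.Binary.Definitions using (Decidable; Symmetric; Irreflexive)
open import Relation.Binary.PropositionalEquality using (_≡_; refl)
open import Relation.Nullary.Decidable using (Dec; yes; no; does; map′; _×-dec_; _⊎-dec_; _→-dec_)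

-- Every word of length n over the letters xs (each once if xs has no repeats).
words : ∀ {A : Set} → List A → (n : ℕ) → List (Vec A n)
words xs zero    = [] ∷ []
words xs (suc n) = cartesianProductWith _∷_ xs (words xs n)

------------------------------------------------------------------------
-- Finite simple graphs on n vertices, neighbourhoods and twins

record Graph (n : ℕ) : Set₁ where
  field
    Adj    : Rel (Fin n) 0ℓ
    adj?   : Decidable Adj
    sym    : Symmetric Adj
    irrefl : Irreflexive _≡_ Adj

  N : Fin n → Subset n
  N i = tabulate (λ j → does (adj? i j))

  TwinPair : Fin n × Fin n → Set
  TwinPair (i , j) = toℕ j ≡ suc (toℕ i) × Adj i j × N i - j ≡ N j - i

  twinPair? : ∀ p → Dec (TwinPair p)
  twinPair? (i , j) = (toℕ j ≟ suc (toℕ i)) ×-dec adj? i j ×-dec ≡-dec Bool._≟_ (N i - j) (N j - i)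

  twin : ℕ
  twin = length (filter twinPair? (cartesianProduct (allFin n) (allFin n)))

------------------------------------------------------------------------
-- Area sequences and their unit interval graphs

-- The element i of Fin n stands for the element label i of [n] = {1,…,n}.
label : ∀ {n} → Fin n → ℕ
label i = suc (toℕ i)

IsAreaSequence : ∀ {n} → Vec ℕ n → Set
IsAreaSequence {n} a =
  (∀ (i : Fin n) → lookup a i < label i) ×
  (∀ (h i : Fin n) → label i ≡ suc (label h) → lookup a i ≤ lookup a h + 1)

isAreaSequence? : ∀ {n} (a : Vec ℕ n) → Dec (IsAreaSequence a)
isAreaSequence? a =
  all? (λ i → lookup a i <? label i) ×-dec
  all? (λ h → all? (λ i → (label i ≟ suc (label h)) →-dec (lookup a i ≤? lookup a h + 1)))

-- Nothing is missed by taking the entries from {0,…,n-1}, since aᵢ < i ≤ n.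
DP : (n : ℕ) → List (Vec ℕ n)
DP n = filter isAreaSequence? (words (upTo n) n)

module _ {n : ℕ} (a : Vec ℕ n) where

  -- {j,i} is an edge, j being its smaller endpoint.  The truncated subtraction
  -- is harmless, because aᵢ < i in an area sequence.
  Edge : Rel (Fin n) 0ℓ
  Edge j i = label j < label i × label i ∸ lookup a i ≤ label j

  edge? : Decidable Edge
  edge? j i = (label j <? label i) ×-dec (label i ∸ lookup a i ≤? label j)

  Γ : Graph n
  Γ = record
    { Adj    = λ x y → Edge x y ⊎ Edge y x
    ; adj?   = λ x y → edge? x y ⊎-dec edge? y x
    ; sym    = swap
    ; irrefl = λ { refl (inj₁ (x<x , _)) → ℕ.<-irrefl refl x<x
                 ; refl (inj₂ (x<x , _)) → ℕ.<-irrefl refl x<x }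
    }

twin : ∀ {n} → Vec ℕ n → ℕ
twin a = Graph.twin (Γ a)

τ : ℕ → ℕ → ℕ
τ n k = length (filter (λ a → twin a ≟ k) (DP n))

------------------------------------------------------------------------
-- Motzkin numbers

data Step : Set where
  up down flat : Step

-- MotzkinFrom h s: the path with steps s that starts at height h stays
-- weakly above the axis and ends on it.
data MotzkinFrom : ∀ {k} → ℕ → Vec Step k → Set where
  end  : MotzkinFrom 0 []
  up   : ∀ {k h} {s : Vec Step k} → MotzkinFrom (suc h) s → MotzkinFrom h (up ∷ s)
  down : ∀ {k h} {s : Vec Step k} → MotzkinFrom h s → MotzkinFrom (suc h) (down ∷ s)
  flat : ∀ {k h} {s : Vec Step k} → MotzkinFrom h s → MotzkinFrom h (flat ∷ s)

motzkinFrom? : ∀ {k} h (s : Vec Step k) → Dec (MotzkinFrom h s)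
motzkinFrom? zero    []         = yes end
motzkinFrom? (suc h) []         = no λ ()
motzkinFrom? h       (up ∷ s)   = map′ up (λ { (up p) → p }) (motzkinFrom? (suc h) s)
motzkinFrom? zero    (down ∷ s) = no λ ()
motzkinFrom? (suc h) (down ∷ s) = map′ down (λ { (down p) → p }) (motzkinFrom? h s)
motzkinFrom? h       (flat ∷ s) = map′ flat (λ { (flat p) → p }) (motzkinFrom? h s)

M : ℕ → ℕ
M k = length (filter (motzkinFrom? 0) (words (up ∷ down ∷ flat ∷ []) k))

-- The rows of the triangle are m ≥ 1, with 0 ≤ k ≤ m-1.
A091869 : ℕ → ℕ → ℕ
A091869 m k = ((m ∸ 1) C k) * M (m ∸ 1 ∸ k)

------------------------------------------------------------------------
-- Coefficients of ₂F₁(a,b;c;z)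

ℕ→ℚ : ℕ → ℚ
ℕ→ℚ i = + i ℚ./ 1

-- Rising factorial (a)ᵢ = a(a+1)⋯(a+i-1)
pochhammer : ℚ → ℕ → ℚ
pochhammer a zero    = ℚ.1ℚ
pochhammer a (suc i) = pochhammer a i ℚ.* (a ℚ.+ ℕ→ℚ i)

-- Holds exactly when c is not one of 0, -1, -2, …
Admissible : ℚ → Set
Admissible c = ∀ i → ℚ.NonZero (pochhammer c i)

₂F₁-coeff : (a b c : ℚ) → Admissible c → ℕ → ℚ
₂F₁-coeff a b c c-ok i =
  ((pochhammer a i ℚ.* pochhammer b i) ℚ.÷ pochhammer c i) ℚ.* (+ 1 ℚ./ (i !))
  where instance
    _ = c-ok i
    _ = i !≢0

2ℚ : ℚ
2ℚ = ℕ→ℚ 2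

2-admissible : Admissible 2ℚ
2-admissible i = ℚ.pos⇒nonZero (pochhammer 2ℚ i) {{positive i}}
  where
  positive : ∀ i → ℚ.Positive (pochhammer 2ℚ i)
  positive zero    = _
  positive (suc i) = ℚ.pos*pos⇒pos (pochhammer 2ℚ i) {{positive i}} (2ℚ ℚ.+ ℕ→ℚ i)
    {{ℚ.pos+nonNeg⇒pos 2ℚ (ℕ→ℚ i) {{ℚ.normalize-nonNeg i 1}}}}

------------------------------------------------------------------------
-- Generating polynomial and ₂F₁ in a commutative ring R, with coefficients
-- read in R along φ : ℚ → R

module RingNotation {r ℓ} (R : CommutativeRing r ℓ) where
  open CommutativeRing R public
    using (Carrier; _≈_; 0#; 1#; rawRing; semiring) renaming (_+_ to _⊕_; _*_ to _⊛_)
  open import Algebra.Properties.Semiring.Exp semiring public using (_^_)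
  open import Algebra.Properties.Semiring.Mult semiring public using () renaming (_×_ to _·_)
  open import Algebra.Properties.Semiring.Sum semiring public using (sum-syntax; sum⁺-syntax)

module _ {r ℓ} (R : CommutativeRing r ℓ) where
  open RingNotation R

  twinPoly : ℕ → Carrier → Carrier
  twinPoly n t = foldr _⊕_ 0# (map (λ a → t ^ twin a) (DP n))

  ₂F₁-partialSum : (φ : ℚ → Carrier) (a b c : ℚ) → Admissible c → Carrier → ℕ → Carrier
  ₂F₁-partialSum φ a b c c-ok z m = ∑[ i < m ] (φ (₂F₁-coeff a b c c-ok (toℕ i)) ⊛ z ^ toℕ i)

  -- s is the value of ₂F₁(a,b;c;z).  R carries no topology, so the partial sums
  -- are required to be eventually equal to s; this is the sum of the series
  -- when it terminates, i.e. when a or b is one of 0, -1, -2, …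
  Is₂F₁ : (φ : ℚ → Carrier) (a b c : ℚ) → Admissible c → (z s : Carrier) → Set ℓ
  Is₂F₁ φ a b c c-ok z s = ∃ λ m₀ → ∀ m → m ≥ m₀ → ₂F₁-partialSum φ a b c c-ok z m ≈ s

-- Write bᵢ = i − aᵢ for the left end of the closed neighbourhood of i.  Then b
-- is weakly increasing with 1 ≤ bᵢ ≤ i, and (k , k + 1) is a twin pair iff
-- b stays the same from k to k + 1 and k + 1 is not a value of b.  Reading for
-- each k the two bits "bₖ₊₁ = bₖ" and "k + 1 is a value of b" gives a Motzkin
-- path with two kinds of flat steps, one of which marks the twins: the height
-- at k is the number of values of b in (bₖ , k] that still have to occur.
-- Keeping these values in a queue inverts the construction.  In paths of
-- length n, choosing the positions of the k twins gives (n C k) M_{n−k}, and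
-- choosing instead the positions of the non-flat steps gives
-- Σⱼ (n C 2j) Catⱼ (1 + t)ⁿ⁻²ʲ, which is the hypergeometric series.
module Submission where

open import Defs
open import Algebra.Bundles using (CommutativeRing)
open import Algebra.Morphism.Structures using (IsRingHomomorphism)
open import Data.Fin.Base using (toℕ)
open import Data.Integer.Base as ℤ using (+_)
open import Data.Nat.Base using (ℕ; suc; _*_; _∸_; _≤_; _<_)
open import Data.Nat.Combinatorics using (_C_)
open import Data.Product.Base using (_×_; ∃)
open import Data.Rational.Base as ℚ using (ℚ)
open import Relation.Binary.PropositionalEquality using (_≡_)

-- The second bit of a letter is not local: whether k + 1 is a value of b is settled only further
-- on. For a given sequence it is a lookahead; for a given word it is a promise, and the height
-- counts the promises still open. As b never decreases, promises are kept in the order in which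
-- they were made. So each jump of b goes to the oldest open promise, and one bit "b changes" is
-- enough to know the new value.
--
-- The formulas are not obtained by choosing positions in a path. The multiset of twin numbers of
-- all paths from a given height satisfies a single recursion by the first letter. The Motzkin
-- formula solves this recursion for each power of t separately, and the sum with Catalan numbers
-- solves it for the polynomial as a whole. The starting height has to stay arbitrary throughout,
-- because removing the first letter changes it.

module TwinCounting where

  open import Data.Bool.Base using (Bool; true; false)
  import Data.Bool.Properties as Bool
  open import Data.Empty using (⊥; ⊥-elim)
  open import Data.Fin.Base using (Fin; zero; suc; inject₁; fromℕ<)
  open import Data.Fin.Properties using (toℕ-inject₁; toℕ-injective; toℕ-fromℕ<; toℕ<n)
  open import Data.Fin.Subset using (Subset; _-_) renaming (_∈_ to _∈ₛ_)
  open import Data.Fin.Subset.Properties using (⊆-antisym; x∈p∧x≢y⇒x∈p-y; p─q⊆p)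
  open import Data.List.Base as List using (List; []; _∷_; _∷ʳ_; _++_; map; length; filter; upTo; allFin; cartesianProduct)
  open import Data.List.Membership.Propositional using () renaming (_∈_ to _∈ₗ_)
  open import Data.List.Membership.Propositional.Properties
    using ( ∈-++⁺ˡ; ∈-++⁺ʳ; ∈-++⁻; ∈-map⁺; ∈-map⁻; ∈-cartesianProduct⁺; ∈-cartesianProductWith⁺
          ; ∈-allFin; ∈-upTo⁺; ∈-filter⁺; ∈-filter⁻)
  open import Data.List.Membership.Propositional.Properties.WithK using (unique∧set⇒bag)
  open import Data.List.Properties
    using ( map-id-local; map-cong-local; map-∘; map-tabulate; map-++; filter-++; filter-≐; filter-none
          ; length-++; length-map; ++-identityʳ)
  open import Data.List.Relation.Binary.BagAndSetEquality using (∼bag⇒↭)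
  open import Data.List.Relation.Binary.Permutation.Propositional using (_↭_; ↭-reflexive; ↭-trans)
  import Data.List.Relation.Binary.Permutation.Propositional.Properties as ↭
  open import Data.List.Relation.Unary.All as All using (All; []; _∷_)
  import Data.List.Relation.Unary.All.Properties as All
  open import Data.List.Relation.Unary.AllPairs using (AllPairs; []; _∷_)
  import Data.List.Relation.Unary.AllPairs.Properties as AllPairs
  open import Data.List.Relation.Unary.Any using (here; there)
  open import Data.List.Relation.Unary.Unique.DecPropositional using (unique?)
  open import Data.List.Relation.Unary.Unique.Propositional using (Unique)
  import Data.List.Relation.Unary.Unique.Propositional.Properties as Unique
  open import Data.Nat.Base
  open import Data.Nat.Combinatorics using (nCk+nC[k+1]≡[n+1]C[k+1]; k>n⇒nCk≡0; nC1≡n)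
  open import Data.Nat.Combinatorics.Base using (_P′_)
  open import Data.Nat.Properties
  open import Data.Nat.Solver using (module +-*-Solver)
  open import Data.Product.Base using (_,_; proj₁; proj₂)
  open import Data.Product.Properties using (≡-dec)
  open import Data.Sum.Base using (inj₁; inj₂)
  open import Data.Unit.Base using (⊤; tt)
  open import Data.Vec.Base as Vec using (Vec; []; _∷_; lookup; tabulate; tail; count; here; there)
  open import Data.Vec.Membership.DecPropositional _≟_ using (_∈?_)
  open import Data.Vec.Membership.Propositional using (_∈_; _∉_)
  open import Data.Vec.Membership.Propositional.Properties using (∈-lookup)
  open import Data.Vec.Properties using (tabulate-cong; tabulate∘lookup; lookup∘tabulate; lookup⇒[]=; []=⇒lookup; ∷-injective)
  open import Data.Vec.Relation.Unary.Any using (here; there; index)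
  open import Data.Vec.Relation.Unary.Any.Properties using (lookup-index)
  open import Function.Base using (_∘_; id)
  open import Function.Bundles using (_⇔_; mk⇔; Equivalence)
  open import Level using (Level)
  open import Relation.Binary.Definitions using (tri<; tri≈; tri>)
  open import Relation.Binary.PropositionalEquality
  open import Relation.Nullary.Decidable using (Dec; yes; no; does; toWitness; dec-true; dec-false; does-⇔)
  open import Relation.Nullary.Negation using (¬_)
  open import Relation.Unary using (Pred; Decidable)

  -- Words of letters and their correspondence with weakly increasing sequences

  -- The letter (stay , hit) at k + 1 records whether b stays the same from k to
  -- k + 1 and whether k + 1 is a value of b.
  Letter : Set
  Letter = Bool × Bool

  climb : Bool → ℕ → ℕ
  climb true  h = suc h
  climb false h = h

  -- A letter first rises if hit and then falls unless stay, so that (true , false)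
  -- and (false , true) are the two kinds of flat steps; the former marks a twin.
  mutual
    Balanced : ∀ {m} → ℕ → Vec Letter m → Set
    Balanced h []                  = h ≡ 0
    Balanced h ((true  , hit) ∷ w) = Balanced (climb hit h) w
    Balanced h ((false , hit) ∷ w) = BalancedAfterFall (climb hit h) w

    BalancedAfterFall : ∀ {m} → ℕ → Vec Letter m → Set
    BalancedAfterFall zero    w = ⊥
    BalancedAfterFall (suc h) w = Balanced h w

  mutual
    balanced? : ∀ {m} h (w : Vec Letter m) → Dec (Balanced h w)
    balanced? h []                  = h ≟ 0
    balanced? h ((true  , hit) ∷ w) = balanced? (climb hit h) w
    balanced? h ((false , hit) ∷ w) = balancedAfterFall? (climb hit h) w

    balancedAfterFall? : ∀ {m} h (w : Vec Letter m) → Dec (BalancedAfterFall h w)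
    balancedAfterFall? zero    w = no λ ()
    balancedAfterFall? (suc h) w = balanced? h w

  -- `k` is the position read last and `b` the value there, so `Ascending 1 1 s` describes the left
  -- ends from position 2 on.
  Ascending : ∀ {m} → ℕ → ℕ → Vec ℕ m → Set
  Ascending k b []      = ⊤
  Ascending k b (x ∷ s) = b ≤ x × x ≤ suc k × Ascending (suc k) x s

  -- In an ascending sequence the values up to position `k` are at most `k`, so looking for `suc k`
  -- in the rest `x ∷ s` is as good as looking for it everywhere.
  encode : ∀ {m} → ℕ → ℕ → Vec ℕ m → Vec Letter m
  encode k b []      = []
  encode k b (x ∷ s) = (does (x ≟ b) , does (suc k ∈? (x ∷ s))) ∷ encode (suc k) x s

  push : Bool → ℕ → List ℕ → List ℕ
  push true  v q = q ∷ʳ v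
  push false v q = q

  mutual
    -- The hit is queued before the jump is made, because a jump may go to `suc k` itself: the
    -- letter (false , true) is legal on an empty queue.
    decode : ∀ {m} → ℕ → ℕ → List ℕ → Vec Letter m → Vec ℕ m
    decode k b q []                  = []
    decode k b q ((true  , hit) ∷ w) = b ∷ decode (suc k) b (push hit (suc k) q) w
    decode k b q ((false , hit) ∷ w) = decodeJump (suc k) (push hit (suc k) q) w

    -- The value on the empty queue is junk.
    decodeJump : ∀ {m} → ℕ → List ℕ → Vec Letter m → Vec ℕ (suc m)
    decodeJump k []      w = Vec.replicate _ 0
    decodeJump k (x ∷ q) w = x ∷ decode k x q w

  length-push : ∀ hit v q → length (push hit v q) ≡ climb hit (length q)
  length-push true  v q = trans (length-++ q) (+-comm (length q) 1)
  length-push false v q = refl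

  Queue : ℕ → ℕ → List ℕ → Set
  Queue k b q = AllPairs _<_ q × All (λ v → b < v × v ≤ k) q

  -- Kept apart from `Queue` because it speaks of the future: while a word is decoded, `Queue` is
  -- known beforehand, `Pending` only once the rest of the sequence has been produced. Together they
  -- make `q` the sorted list of the values in (b , k] that occur in `s`.
  record Pending {m} (k b : ℕ) (q : List ℕ) (s : Vec ℕ m) : Set where
    constructor pending
    field
      occurs : ∀ {v} → v ∈ₗ q → v ∈ s
      queued : ∀ {v} → b < v → v ≤ k → v ∈ s → v ∈ₗ q
  open Pending

  queue-push : ∀ {k b q} hit → b ≤ k → Queue k b q → Queue (suc k) b (push hit (suc k) q)
  queue-push {k} true b≤k (asc , bnd) =
    AllPairs.++⁺ asc ([] ∷ []) (All.map (λ { (_ , v≤k) → s≤s v≤k ∷ [] }) bnd) ,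
    All.++⁺ (All.map (λ { (b<v , v≤k) → b<v , m≤n⇒m≤1+n v≤k }) bnd) ((s≤s b≤k , ≤-refl) ∷ [])
  queue-push false _ (asc , bnd) = asc , All.map (λ { (b<v , v≤k) → b<v , m≤n⇒m≤1+n v≤k }) bnd

  queue-pop : ∀ {k b x q} → Queue k b (x ∷ q) → Queue k x q
  queue-pop (x< ∷ asc , (_ ∷ bnd)) = asc , All.zipWith (λ { (x<v , _ , v≤k) → x<v , v≤k }) (x< , bnd)

  module _ {m} (s : Vec ℕ m) where

    pending-push : ∀ {k b q} → Pending k b q s →
                   Pending (suc k) b (push (does (suc k ∈? s)) (suc k) q) s
    pending-push {k} {b} {q} (pending occ que) with suc k ∈? s
    ... | no 1+k∉s = pending occ λ b<v v≤1+k v∈s → que b<v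
          (s≤s⁻¹ (≤∧≢⇒< v≤1+k λ { refl → 1+k∉s v∈s })) v∈s
    ... | yes 1+k∈s = pending occ′ que′
      where
      occ′ : ∀ {v} → v ∈ₗ q ∷ʳ suc k → v ∈ s
      occ′ v∈ with ∈-++⁻ q v∈
      ... | inj₁ v∈q         = occ v∈q
      ... | inj₂ (here refl) = 1+k∈s
      que′ : ∀ {v} → b < v → v ≤ suc k → v ∈ s → v ∈ₗ q ∷ʳ suc k
      que′ {v} b<v v≤1+k v∈s with v ≟ suc k
      ... | yes refl = ∈-++⁺ʳ q (here refl)
      ... | no v≢1+k = ∈-++⁺ˡ (que b<v (s≤s⁻¹ (≤∧≢⇒< v≤1+k v≢1+k)) v∈s)

    -- All entries of `q` are at most `k`, so `suc k` is in the pushed queue exactly when `hit` is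
    -- true; `Pending` turns this into the bit that `encode` computes.
    pending-unpush : ∀ {k b q} hit → b ≤ k → Queue k b q → Pending (suc k) b (push hit (suc k) q) s →
                     does (suc k ∈? s) ≡ hit × Pending k b q s
    pending-unpush {k} {b} {q} true b≤k _ (pending occ que) =
      dec-true (suc k ∈? s) (occ (∈-++⁺ʳ q (here refl))) , pending (λ v∈q → occ (∈-++⁺ˡ v∈q)) que′
      where
      que′ : ∀ {v} → b < v → v ≤ k → v ∈ s → v ∈ₗ q
      que′ b<v v≤k v∈s with ∈-++⁻ q (que b<v (m≤n⇒m≤1+n v≤k) v∈s)
      ... | inj₁ v∈q         = v∈q
      ... | inj₂ (here refl) = ⊥-elim (1+n≰n v≤k)
    pending-unpush {k} false b≤k (_ , bnd) (pending occ que) =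
      dec-false (suc k ∈? s) (λ 1+k∈s → 1+n≰n (proj₂ (All.lookup bnd (que (s≤s b≤k) ≤-refl 1+k∈s)))) ,
      pending occ (λ b<v v≤k v∈s → que b<v (m≤n⇒m≤1+n v≤k) v∈s)

  ascending-≤ : ∀ {m k b v} (s : Vec ℕ m) → Ascending k b s → v ∈ s → b ≤ v
  ascending-≤ (x ∷ s) (b≤x , _ , _)   (here refl) = b≤x
  ascending-≤ (x ∷ s) (b≤x , _ , asc) (there v∈s) = ≤-trans b≤x (ascending-≤ s asc v∈s)

  pending-stay : ∀ {m k b q} {s : Vec ℕ m} → Queue k b q → Pending k b q (b ∷ s) → Pending k b q s
  pending-stay {b = b} {q} {s} (_ , bnd) (pending occ que) = pending occ′ (λ b<v v≤k v∈s → que b<v v≤k (there v∈s))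
    where
    occ′ : ∀ {v} → v ∈ₗ q → v ∈ s
    occ′ v∈q with occ v∈q
    ... | here refl = ⊥-elim (<-irrefl refl (proj₁ (All.lookup bnd v∈q)))
    ... | there v∈s = v∈s

  pending-unstay : ∀ {m k b q} {s : Vec ℕ m} → Pending k b q s → Pending k b q (b ∷ s)
  pending-unstay {k = k} {b} {q} {s} (pending occ que) = pending (λ v∈q → there (occ v∈q)) que′
    where
    que′ : ∀ {v} → b < v → v ≤ k → v ∈ b ∷ s → v ∈ₗ q
    que′ b<v v≤k (here refl) = ⊥-elim (<-irrefl refl b<v)
    que′ b<v v≤k (there v∈s) = que b<v v≤k v∈s

  pending-pop : ∀ {m k b x q} {s : Vec ℕ m} → Queue k b (x ∷ q) →
                Pending k b (x ∷ q) (x ∷ s) → Pending k x q s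
  pending-pop {k = k} {b} {x} {q} {s} (x< ∷ _ , (b<x , _) ∷ _) (pending occ que) = pending occ′ que′
    where
    occ′ : ∀ {v} → v ∈ₗ q → v ∈ s
    occ′ v∈q with occ (there v∈q)
    ... | here refl = ⊥-elim (<-irrefl refl (All.lookup x< v∈q))
    ... | there v∈s = v∈s
    que′ : ∀ {v} → x < v → v ≤ k → v ∈ s → v ∈ₗ q
    que′ x<v v≤k v∈s with que (<-trans b<x x<v) v≤k (there v∈s)
    ... | here refl = ⊥-elim (<-irrefl refl x<v)
    ... | there v∈q = v∈q

  -- Lowering the bound from `x` to `b` brings in no value besides `x`: since `s` ascends from `x`,
  -- none of its values is smaller.
  pending-unpop : ∀ {m k b x q} {s : Vec ℕ m} → Ascending k x s →
                  Pending k x q s → Pending k b (x ∷ q) (x ∷ s)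
  pending-unpop {k = k} {b} {x} {q} {s} asc (pending occ que) = pending occ′ que′
    where
    occ′ : ∀ {v} → v ∈ₗ x ∷ q → v ∈ x ∷ s
    occ′ (here refl) = here refl
    occ′ (there v∈q) = there (occ v∈q)
    que′ : ∀ {v} → b < v → v ≤ k → v ∈ x ∷ s → v ∈ₗ x ∷ q
    que′ {v} b<v v≤k (here refl) = here refl
    que′ {v} b<v v≤k (there v∈s) with v ≟ x
    ... | yes refl = here refl
    ... | no v≢x   = there (que (≤∧≢⇒< (ascending-≤ s asc v∈s) (≢-sym v≢x)) v≤k v∈s)

  -- The jump target `x` is itself queued, so the head is at most `x`; but the head still occurs in
  -- `x ∷ s`, where nothing is smaller than `x`.
  head-of-queue : ∀ {m k b x q} {s : Vec ℕ m} → Queue k b q → Ascending k x s → b < x → x ≤ k →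
                  Pending k b q (x ∷ s) → ∀ {h t} → q ≡ h ∷ t → h ≡ x
  head-of-queue {s = s} (h< ∷ _ , _) asc b<x x≤k (pending occ que) refl with que b<x x≤k (here refl)
  ... | here refl = refl
  ... | there x∈t with occ (here refl)
  ...   | here refl = refl
  ...   | there h∈s = ⊥-elim (<⇒≱ (All.lookup h< x∈t) (ascending-≤ s asc h∈s))

  -- The queue q of the values in (b , k] that still have to occur in s has as
  -- many elements as the height of the path read so far.
  decode-encode : ∀ {m} k b q (s : Vec ℕ m) → b ≤ k → Queue k b q → Ascending k b s → Pending k b q s →
                  Balanced (length q) (encode k b s) × decode k b q (encode k b s) ≡ s
  decode-encode k b []      [] _ _ _ _   = refl , refl
  decode-encode k b (v ∷ q) [] _ _ _ pen with () ← occurs pen (here refl)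
  decode-encode k b q (x ∷ s) b≤k Q (b≤x , x≤1+k , asc) pen =
    -- Only the decision is split into cases; `length-push` treats both values of the bit alike.
    go (x ≟ b) (does (suc k ∈? (x ∷ s))) (queue-push (does (suc k ∈? (x ∷ s))) b≤k Q) (pending-push (x ∷ s) pen)
    where
    go : ∀ (x≟b : Dec (x ≡ b)) hit → Queue (suc k) b (push hit (suc k) q) →
         Pending (suc k) b (push hit (suc k) q) (x ∷ s) →
         let w = (does x≟b , hit) ∷ encode (suc k) x s in
         Balanced (length q) w × decode k b q w ≡ x ∷ s
    go (yes refl) hit Q′ pen′ =
      let bal , eq = decode-encode (suc k) b _ s (m≤n⇒m≤1+n b≤k) Q′ asc (pending-stay Q′ pen′)
      in subst (λ h → Balanced h (encode (suc k) b s)) (length-push hit (suc k) q) bal , cong (b ∷_) eq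
    go (no x≢b) hit Q′ pen′ =
      let bal , eq = jump _ Q′ pen′
      in subst (λ h → BalancedAfterFall h (encode (suc k) x s)) (length-push hit (suc k) q) bal , eq
      where
      b<x = ≤∧≢⇒< b≤x (≢-sym x≢b)
      jump : ∀ q′ → Queue (suc k) b q′ → Pending (suc k) b q′ (x ∷ s) →
             let w = encode (suc k) x s in
             BalancedAfterFall (length q′) w × decodeJump (suc k) q′ w ≡ x ∷ s
      -- The junk value of `decodeJump` is never reached: `x` lies in (b , k + 1] and occurs, hence
      -- it is queued.
      jump []      Q″ p with () ← queued p b<x x≤1+k (here refl)
      jump (h ∷ t) Q″ p with refl ← head-of-queue Q″ asc b<x x≤1+k p refl =
        let bal , eq = decode-encode (suc k) x t s x≤1+k (queue-pop Q″) asc (pending-pop Q″ p)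
        in bal , cong (x ∷_) eq

  -- Here `Pending` is a conclusion. That every queued value does occur comes from the end of the
  -- word: height 0 there means an empty queue. It must be proved along with the equation, because
  -- the hit bits of `encode` depend on the decoded remainder.
  encode-decode : ∀ {m} k b q (w : Vec Letter m) → b ≤ k → Queue k b q → Balanced (length q) w →
                  let s = decode k b q w in
                  Ascending k b s × Pending k b q s × encode k b s ≡ w
  encode-decode k b [] [] b≤k Q bal = tt , pending (λ ()) (λ _ _ ()) , refl
  encode-decode k b q ((true , hit) ∷ w) b≤k Q bal =
    let Q′ = queue-push hit b≤k Q
        asc , pen , eq = encode-decode (suc k) b _ w (m≤n⇒m≤1+n b≤k) Q′
                           (subst (λ h → Balanced h w) (sym (length-push hit (suc k) q)) bal)
        hit-eq , pen′ = pending-unpush _ hit b≤k Q (pending-unstay pen)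
    in (≤-refl , m≤n⇒m≤1+n b≤k , asc) , pen′ ,
       cong₂ _∷_ (cong₂ _,_ (dec-true (b ≟ b) refl) hit-eq) eq
  encode-decode k b q ((false , hit) ∷ w) b≤k Q bal =
    go (push hit (suc k) q) refl (queue-push hit b≤k Q)
       (subst (λ h → BalancedAfterFall h w) (sym (length-push hit (suc k) q)) bal)
    where
    go : ∀ q′ → push hit (suc k) q ≡ q′ → Queue (suc k) b q′ → BalancedAfterFall (length q′) w →
         let s = decodeJump (suc k) q′ w in
         Ascending k b s × Pending k b q s × encode k b s ≡ (false , hit) ∷ w
    go (x ∷ q″) q′≡ Q′@(_ , (b<x , x≤1+k) ∷ _) bal′ =
      let asc , pen , eq = encode-decode (suc k) x q″ w x≤1+k (queue-pop Q′) bal′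
          hit-eq , pen′ = pending-unpush _ hit b≤k Q
            (subst (λ p → Pending (suc k) b p _) (sym q′≡) (pending-unpop asc pen))
      in (<⇒≤ b<x , x≤1+k , asc) , pen′ ,
         cong₂ _∷_ (cong₂ _,_ (dec-false (x ≟ b) (≢-sym (<⇒≢ b<x))) hit-eq) eq

  -- From area sequences to balanced words and back

  -- Subtraction from the position is an involution, so this map also turns left ends back into an
  -- area sequence.
  leftEnds : ∀ {n} → Vec ℕ n → Vec ℕ n
  leftEnds a = tabulate λ i → label i ∸ lookup a i

  lookup-leftEnds : ∀ {n} (a : Vec ℕ n) i → lookup (leftEnds a) i ≡ label i ∸ lookup a i
  lookup-leftEnds a = lookup∘tabulate _

  leftEnds-involutive : ∀ {n} (a : Vec ℕ n) → (∀ i → lookup a i ≤ label i) → leftEnds (leftEnds a) ≡ a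
  leftEnds-involutive a a≤ = trans
    (tabulate-cong λ i → trans (cong (label i ∸_) (lookup-leftEnds a i)) (m∸[m∸n]≡n (a≤ i)))
    (tabulate∘lookup a)

  ascending-upper : ∀ {m k b} (s : Vec ℕ m) → Ascending k b s → ∀ i → lookup s i ≤ suc (k + toℕ i)
  ascending-upper {k = k} (x ∷ s) (_ , x≤1+k , _) zero rewrite +-identityʳ k = x≤1+k
  ascending-upper {k = k} (x ∷ s) (_ , _ , asc) (suc i) rewrite +-suc k (toℕ i) = ascending-upper s asc i

  ascending-step : ∀ {m k b} (s : Vec ℕ m) → Ascending k b s → ∀ i → lookup (b ∷ s) (inject₁ i) ≤ lookup s i
  ascending-step (x ∷ s) (b≤x , _ , _)  zero    = b≤x
  ascending-step (x ∷ s) (_ , _ , asc) (suc i) = ascending-step s asc i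

  ascending⁺ : ∀ {m k b} (s : Vec ℕ m) → (∀ i → lookup s i ≤ suc (k + toℕ i)) →
               (∀ i → lookup (b ∷ s) (inject₁ i) ≤ lookup s i) → Ascending k b s
  ascending⁺ []      _ _ = tt
  ascending⁺ {k = k} (x ∷ s) upper step =
    step zero , subst (λ m → x ≤ suc m) (+-identityʳ k) (upper zero) ,
    ascending⁺ s (λ i → subst (λ m → lookup s i ≤ suc m) (+-suc k (toℕ i)) (upper (suc i))) (step ∘ suc)

  -- The first left end is always 1 and carries no information, so reading starts with `k` and `b`
  -- equal to 1, and size n + 1 gives n letters. This is the shift of index in the formula for `τ`.
  path : ∀ {n} → Vec ℕ (suc n) → Vec Letter n
  path a = encode 1 1 (tail (leftEnds a))

  areaSequence : ∀ {n} → Vec Letter n → Vec ℕ (suc n)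
  areaSequence w = leftEnds (1 ∷ decode 1 1 [] w)

  module _ {n} (a : Vec ℕ (suc n)) (area : IsAreaSequence a) where

    private
      s = tail (leftEnds a)

    leftEnds-∷ : leftEnds a ≡ 1 ∷ s
    leftEnds-∷ = cong (λ x → (1 ∸ x) ∷ s) (n<1⇒n≡0 (proj₁ area zero))

    leftEnds-ascending : Ascending 1 1 s
    leftEnds-ascending = ascending⁺ s upper step
      where
      upper : ∀ i → lookup s i ≤ suc (suc (toℕ i))
      upper i = ≤-trans (≤-reflexive (lookup-leftEnds a (suc i))) (m∸n≤m _ (lookup a (suc i)))
      step : ∀ i → lookup (1 ∷ s) (inject₁ i) ≤ lookup s i
      step i = begin
        lookup (1 ∷ s) (inject₁ i)                      ≡⟨ cong (λ v → lookup v (inject₁ i)) leftEnds-∷ ⟨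
        lookup (leftEnds a) (inject₁ i)                 ≡⟨ lookup-leftEnds a (inject₁ i) ⟩
        suc (toℕ (inject₁ i)) ∸ lookup a (inject₁ i)    ≡⟨ cong (λ j → suc j ∸ lookup a (inject₁ i)) (toℕ-inject₁ i) ⟩
        suc (suc (toℕ i)) ∸ suc (lookup a (inject₁ i))  ≤⟨ ∸-monoʳ-≤ (suc (suc (toℕ i))) a-step ⟩
        suc (suc (toℕ i)) ∸ lookup a (suc i)            ≡⟨ lookup-leftEnds a (suc i) ⟨
        lookup (leftEnds a) (suc i)                     ∎
        where
        open ≤-Reasoning
        a-step : lookup a (suc i) ≤ suc (lookup a (inject₁ i))
        a-step = ≤-trans
          (proj₂ area (inject₁ i) (suc i) (cong (λ j → suc (suc j)) (sym (toℕ-inject₁ i))))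
          (≤-reflexive (+-comm _ 1))

    private
      inverse = decode-encode 1 1 [] s ≤-refl ([] , [])
        leftEnds-ascending (pending (λ ()) (λ 1<v v≤1 _ → ⊥-elim (<⇒≱ 1<v v≤1)))

    path-balanced : Balanced 0 (path a)
    path-balanced = proj₁ inverse

    areaSequence-path : areaSequence (path a) ≡ a
    areaSequence-path = begin
      leftEnds (1 ∷ decode 1 1 [] (path a))  ≡⟨ cong (λ v → leftEnds (1 ∷ v)) (proj₂ inverse) ⟩
      leftEnds (1 ∷ s)                       ≡⟨ cong leftEnds leftEnds-∷ ⟨
      leftEnds (leftEnds a)                  ≡⟨ leftEnds-involutive a (λ i → <⇒≤ (proj₁ area i)) ⟩
      a                                      ∎
      where open ≡-Reasoning

  module _ {n} (w : Vec Letter n) (bal : Balanced 0 w) where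

    private
      s = decode 1 1 [] w
      inverse = encode-decode 1 1 [] w ≤-refl ([] , []) bal
      asc = proj₁ inverse

      s≤ : ∀ i → lookup (1 ∷ s) i ≤ label i
      s≤ zero    = ≤-refl
      s≤ (suc i) = ascending-upper s asc i

      1≤s : ∀ i → 1 ≤ lookup (1 ∷ s) i
      1≤s zero    = ≤-refl
      1≤s (suc i) = ascending-≤ s asc (∈-lookup i s)

    areaSequence-isAreaSequence : IsAreaSequence (areaSequence w)
    areaSequence-isAreaSequence = bounded , step
      where
      open ≤-Reasoning
      bounded : ∀ i → lookup (areaSequence w) i < label i
      bounded i = begin-strict
        lookup (areaSequence w) i       ≡⟨ lookup-leftEnds (1 ∷ s) i ⟩
        label i ∸ lookup (1 ∷ s) i      ≤⟨ ∸-monoʳ-≤ (label i) (1≤s i) ⟩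
        toℕ i                           <⟨ ≤-refl ⟩
        label i                         ∎
      step : ∀ h i → label i ≡ suc (label h) → lookup (areaSequence w) i ≤ lookup (areaSequence w) h + 1
      step h (suc i) eq with refl ← toℕ-injective (trans (suc-injective (suc-injective (sym eq))) (sym (toℕ-inject₁ i))) = begin
        lookup (areaSequence w) (suc i)             ≡⟨ lookup-leftEnds (1 ∷ s) (suc i) ⟩
        label (suc i) ∸ lookup s i                  ≤⟨ ∸-monoʳ-≤ (label (suc i)) (ascending-step s asc i) ⟩
        label (suc i) ∸ lookup (1 ∷ s) h            ≡⟨ cong (_∸ lookup (1 ∷ s) h) (trans eq (+-comm 1 (label h))) ⟩
        label h + 1 ∸ lookup (1 ∷ s) h              ≡⟨ +-∸-comm 1 (s≤ h) ⟩
        label h ∸ lookup (1 ∷ s) h + 1              ≡⟨ cong (_+ 1) (lookup-leftEnds (1 ∷ s) h) ⟨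
        lookup (areaSequence w) h + 1               ∎

    path-areaSequence : path (areaSequence w) ≡ w
    path-areaSequence = trans
      (cong (encode 1 1 ∘ tail) (leftEnds-involutive (1 ∷ s) s≤))
      (proj₂ (proj₂ inverse))

  -- `encode` tests the remaining suffix, the statement all of `s`. The skipped entries are bounded
  -- by their own positions, hence smaller than the value sought.
  lookup-encode : ∀ {m k b} (s : Vec ℕ m) → Ascending k b s → ∀ i →
    lookup (encode k b s) i ≡ (does (lookup s i ≟ lookup (b ∷ s) (inject₁ i)) , does (suc (k + toℕ i) ∈? s))
  lookup-encode {k = k} {b} (x ∷ s) _ zero =
    cong (λ j → does (x ≟ b) , does (suc j ∈? (x ∷ s))) (sym (+-identityʳ k))
  lookup-encode {k = k} (x ∷ s) (_ , x≤1+k , asc) (suc i) = trans (lookup-encode s asc i)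
    (cong (does (lookup s i ≟ lookup (x ∷ s) (inject₁ i)) ,_)
      (trans (cong (λ j → does (suc j ∈? s)) (sym (+-suc k (toℕ i))))
        (does-⇔ (mk⇔ there drop) (suc (k + suc (toℕ i)) ∈? s) (suc (k + suc (toℕ i)) ∈? (x ∷ s)))))
    where
    drop : suc (k + suc (toℕ i)) ∈ x ∷ s → suc (k + suc (toℕ i)) ∈ s
    drop (there ∈s) = ∈s
    drop (here eq)  = ⊥-elim (<⇒≱ (s≤s (≤-trans (m≤m+n (suc k) (toℕ i)) (≤-reflexive (sym (+-suc k (toℕ i))))))
                               (≤-trans (≤-reflexive eq) x≤1+k))

  -- Twin pairs of the graph as letters of the word

  twinned? : (l : Letter) → Dec (l ≡ (true , false))
  twinned? l = ≡-dec Bool._≟_ Bool._≟_ l (true , false)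

  module _ {n} (G : Graph n) where
    open Graph G using (Adj; adj?; N)

    ∈-N⁺ : ∀ {i h} → Adj i h → h ∈ₛ N i
    ∈-N⁺ {i} {h} i~h = lookup⇒[]= h (N i) (trans (lookup∘tabulate _ h) (dec-true (adj? i h) i~h))

    ∈-N⁻ : ∀ {i h} → h ∈ₛ N i → Adj i h
    ∈-N⁻ {i} {h} h∈N with adj? i h | trans (sym (lookup∘tabulate (λ j → does (adj? i j)) h)) ([]=⇒lookup h∈N)
    ... | yes i~h | _ = i~h

  dec-true-false⁻ : ∀ {p q} {P : Set p} {Q : Set q} (P? : Dec P) (Q? : Dec Q) →
                    (does P? , does Q?) ≡ (true , false) → P × ¬ Q
  dec-true-false⁻ (yes p) (no ¬q) refl = p , ¬q

  x∉p-x : ∀ {n} (p : Subset n) x → ¬ (x ∈ₛ p - x)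
  x∉p-x (s ∷ p) zero    ()
  x∉p-x (s ∷ p) (suc x) (there x∈) = x∉p-x p x x∈

  module _ {n} (a : Vec ℕ n) (area : IsAreaSequence a) where
    open Graph (Γ a) using (Adj; N; TwinPair) renaming (irrefl to Adj-irrefl)

    private
      β : Fin n → ℕ
      β i = label i ∸ lookup a i

      1≤β : ∀ i → 1 ≤ β i
      1≤β i = m<n⇒0<n∸m (proj₁ area i)

    module _ {i j : Fin n} (j≡1+i : toℕ j ≡ suc (toℕ i)) where

      private
        i<j : label i < label j
        i<j = s≤s (≤-reflexive (sym j≡1+i))

        label-j : label j ≡ suc (label i)
        label-j = cong suc j≡1+i

      leftEnd-step : β i ≤ β j
      leftEnd-step = begin
        label i ∸ lookup a i               ≡⟨⟩
        suc (label i) ∸ suc (lookup a i)   ≤⟨ ∸-monoʳ-≤ (suc (label i))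
          (≤-trans (proj₂ area i j label-j) (≤-reflexive (+-comm _ 1))) ⟩
        suc (label i) ∸ lookup a j         ≡⟨ cong (_∸ lookup a j) label-j ⟨
        label j ∸ lookup a j               ∎
        where open ≤-Reasoning

      -- Each failure yields a vertex that separates i from j. If `β i < β j`, the vertex with label
      -- `β i` is a neighbour of i only. If `β h ≡ label j`, then h lies to the right of j and is a
      -- neighbour of j only.
      twinPair⇒ : TwinPair (i , j) → β j ≡ β i × (∀ h → β h ≢ label j)
      twinPair⇒ (_ , i~j , N≡) = ≤-antisym (≮⇒≥ βi≮βj) leftEnd-step , unhit
        where
        reaches : Adj i j → β j ≤ label i
        reaches (inj₁ (_ , βj≤i)) = βj≤i
        reaches (inj₂ (j<i , _))  = ⊥-elim (<-asym i<j j<i)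

        βj≤i : β j ≤ label i
        βj≤i = reaches i~j

        βi≮βj : ¬ β i < β j
        βi≮βj βi<βj = excluded (∈-N⁻ (Γ a) (p─q⊆p _ _ (subst (v ∈ₛ_) N≡
            (x∈p∧x≢y⇒x∈p-y (∈-N⁺ (Γ a) (inj₂ (v<i , ≤-reflexive (sym label-v)))) v≢j))))
          where
          βi-1<n : pred (β i) < n
          βi-1<n = ≤-trans (≤-reflexive (suc-pred (β i) {{>-nonZero (1≤β i)}}))
                           (≤-trans (m∸n≤m (label i) (lookup a i)) (toℕ<n i))
          v : Fin n
          v = fromℕ< βi-1<n
          label-v : label v ≡ β i
          label-v = trans (cong suc (toℕ-fromℕ< βi-1<n)) (suc-pred (β i) {{>-nonZero (1≤β i)}})
          v<i : label v < label i
          v<i = <-≤-trans (subst (_< β j) (sym label-v) βi<βj) βj≤i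
          v≢j : v ≢ j
          v≢j refl = <-asym i<j v<i
          excluded : ¬ Adj j v
          excluded (inj₁ (j<v , _))  = <-asym (<-trans v<i i<j) j<v
          excluded (inj₂ (_ , βj≤v)) = <⇒≱ βi<βj (≤-trans βj≤v (≤-reflexive label-v))

        unhit : ∀ h → β h ≢ label j
        unhit h βh≡j with <-cmp (label h) (label j)
        ... | tri< h<j _ _ = <⇒≱ h<j (subst (_≤ label h) βh≡j (m∸n≤m (label h) (lookup a h)))
        ... | tri≈ _ h≡j _ with refl ← toℕ-injective (suc-injective h≡j) =
          <⇒≱ i<j (subst (_≤ label i) βh≡j βj≤i)
        ... | tri> _ _ j<h with ∈-N⁻ (Γ a) (p─q⊆p _ _ (subst (h ∈ₛ_) (sym N≡)
                (x∈p∧x≢y⇒x∈p-y (∈-N⁺ (Γ a) (inj₁ (j<h , ≤-reflexive βh≡j))) h≢i)))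
          where
          h≢i : h ≢ i
          h≢i refl = <-asym i<j j<h
        ...   | inj₁ (_ , βh≤i) = <⇒≱ i<j (subst (_≤ label i) βh≡j βh≤i)
        ...   | inj₂ (h<i , _)  = <-asym (<-trans i<j j<h) h<i

      -- On the left the neighbourhoods agree because the left ends do. A right neighbour h of j has
      -- `β h ≤ label j`, and equality is excluded, so it reaches i as well.
      twinPair⇐ : β j ≡ β i → (∀ h → β h ≢ label j) → TwinPair (i , j)
      twinPair⇐ βj≡βi unhit = j≡1+i , inj₁ (i<j , βj≤i) , ⊆-antisym (λ {h} → ⊆ˡ h) (λ {h} → ⊆ʳ h)
        where
        βj≤i : β j ≤ label i
        βj≤i = subst (_≤ label i) (sym βj≡βi) (m∸n≤m (label i) (lookup a i))

        ⊆ˡ : ∀ h → h ∈ₛ N i - j → h ∈ₛ N j - i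
        ⊆ˡ h h∈ = x∈p∧x≢y⇒x∈p-y (∈-N⁺ (Γ a) j~h) h≢i
          where
          h≢i : h ≢ i
          h≢i refl = Adj-irrefl refl (∈-N⁻ (Γ a) (p─q⊆p _ _ h∈))
          j~h : Adj j h
          j~h with ∈-N⁻ (Γ a) (p─q⊆p _ _ h∈)
          ... | inj₂ (h<i , βi≤h) = inj₂ (<-trans h<i i<j , subst (_≤ label h) (sym βj≡βi) βi≤h)
          ... | inj₁ (i<h , βh≤i) = inj₁ (≤∧≢⇒< (subst (_≤ label h) (sym label-j) i<h)
                                            (λ j≡h → x∉p-x _ j (subst (_∈ₛ N i - j) (toℕ-injective (suc-injective (sym j≡h))) h∈))
                                         , ≤-trans βh≤i (<⇒≤ i<j))

        ⊆ʳ : ∀ h → h ∈ₛ N j - i → h ∈ₛ N i - j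
        ⊆ʳ h h∈ = x∈p∧x≢y⇒x∈p-y (∈-N⁺ (Γ a) i~h) h≢j
          where
          h≢j : h ≢ j
          h≢j refl = Adj-irrefl refl (∈-N⁻ (Γ a) (p─q⊆p _ _ h∈))
          i~h : Adj i h
          i~h with ∈-N⁻ (Γ a) (p─q⊆p _ _ h∈)
          ... | inj₁ (j<h , βh≤j) = inj₁ (<-trans i<j j<h ,
                                          s≤s⁻¹ (≤-trans (≤∧≢⇒< βh≤j (unhit h)) (≤-reflexive label-j)))
          ... | inj₂ (h<j , βj≤h) = inj₂ (≤∧≢⇒< (s≤s⁻¹ (≤-trans h<j (≤-reflexive label-j)))
                                            (λ h≡i → x∉p-x _ i (subst (_∈ₛ N j - i) (toℕ-injective (suc-injective h≡i)) h∈))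
                                         , subst (_≤ label h) βj≡βi βj≤h)

  module _ {n} (a : Vec ℕ (suc n)) (area : IsAreaSequence a) (i : Fin n) where
    open Graph (Γ a) using (TwinPair)

    private
      s = tail (leftEnds a)

      -- The left end missing from `s` is the first one, which is at most 1 and so cannot be `v`.
      hitAfter⇔ : ∀ {v} → 1 < v → (v ∉ s) ⇔ (∀ h → label h ∸ lookup a h ≢ v)
      hitAfter⇔ {v} 1<v = mk⇔ to from
        where
        to : v ∉ s → ∀ h → label h ∸ lookup a h ≢ v
        to v∉s zero    eq = <⇒≱ 1<v (subst (_≤ 1) eq (m∸n≤m 1 (lookup a zero)))
        to v∉s (suc h) eq = v∉s (subst (_∈ s) (trans (lookup-leftEnds a (suc h)) eq) (∈-lookup h s))
        from : (∀ h → label h ∸ lookup a h ≢ v) → v ∉ s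
        from unhit v∈s = unhit (suc (index v∈s))
          (trans (sym (lookup-leftEnds a (suc (index v∈s)))) (sym (lookup-index v∈s)))

    path-twinned⇔ : TwinPair (inject₁ i , suc i) ⇔ (lookup (path a) i ≡ (true , false))
    path-twinned⇔ = mk⇔ to from
      where
      consecutive = cong suc (sym (toℕ-inject₁ i))
      letter = lookup-encode s (leftEnds-ascending a area) i
      stay? = lookup s i ≟ lookup (1 ∷ s) (inject₁ i)
      hit? = suc (suc (toℕ i)) ∈? s
      previous : lookup (1 ∷ s) (inject₁ i) ≡ label (inject₁ i) ∸ lookup a (inject₁ i)
      previous = trans (cong (λ v → lookup v (inject₁ i)) (sym (leftEnds-∷ a area))) (lookup-leftEnds a (inject₁ i))
      to : TwinPair (inject₁ i , suc i) → lookup (path a) i ≡ (true , false)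
      to tp with βeq , unhit ← twinPair⇒ a area consecutive tp = trans letter (cong₂ _,_
        (dec-true stay? (trans (lookup-leftEnds a (suc i)) (trans βeq (sym previous))))
        (dec-false hit? (Equivalence.from (hitAfter⇔ (s≤s (s≤s z≤n))) unhit)))
      from : lookup (path a) i ≡ (true , false) → TwinPair (inject₁ i , suc i)
      from eq =
        let stay , unhit = dec-true-false⁻ stay? hit? (trans (sym letter) eq)
        in twinPair⇐ a area consecutive
             (trans (sym (lookup-leftEnds a (suc i))) (trans stay previous))
             (Equivalence.to (hitAfter⇔ (s≤s (s≤s z≤n))) unhit)

  -- Enumeration of area sequences and of words

  private
    variable
      ℓ₁ ℓ₂ ℓ₃ : Level
      A : Set ℓ₁
      B : Set ℓ₂

  -- Lists without repetitions that have the same elements are permutations of each other. The maps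
  -- need to be inverse on the listed elements only, as is the case for `path` and `areaSequence`;
  -- mapping `g` over `map f xs` gives back `xs`, which shows that `map f xs` has no repetitions.
  map-↭-inverse : ∀ {xs : List A} {ys : List B} → Unique xs → Unique ys → (f : A → B) (g : B → A) →
                  (∀ {x} → x ∈ₗ xs → f x ∈ₗ ys × g (f x) ≡ x) →
                  (∀ {y} → y ∈ₗ ys → g y ∈ₗ xs × f (g y) ≡ y) → map f xs ↭ ys
  map-↭-inverse {xs = xs} {ys} xs! ys! f g to from =
    ∼bag⇒↭ (unique∧set⇒bag fxs! ys! (mk⇔ forward backward))
    where
    fxs! : Unique (map f xs)
    fxs! = Unique.map⁻ {f = g} (subst Unique
      (sym (trans (sym (map-∘ xs)) (map-id-local (All.tabulate λ x∈ → proj₂ (to x∈))))) xs!)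
    forward : ∀ {y} → y ∈ₗ map f xs → y ∈ₗ ys
    forward y∈ with x , x∈ , refl ← ∈-map⁻ f y∈ = proj₁ (to x∈)
    backward : ∀ {y} → y ∈ₗ ys → y ∈ₗ map f xs
    backward y∈ = subst (_∈ₗ map f xs) (proj₂ (from y∈)) (∈-map⁺ f (proj₁ (from y∈)))

  filter-map : ∀ {P : Pred B ℓ₃} (P? : Decidable P) (f : A → B) xs →
               filter P? (map f xs) ≡ map f (filter (P? ∘ f) xs)
  filter-map P? f []       = refl
  filter-map P? f (x ∷ xs) with does (P? (f x))
  ... | true  = cong (f x ∷_) (filter-map P? f xs)
  ... | false = filter-map P? f xs

  words-unique : ∀ {A : Set} {xs : List A} n → Unique xs → Unique (words xs n)
  words-unique zero    xs! = [] ∷ []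
  words-unique (suc n) xs! = Unique.cartesianProductWith⁺ _∷_ ∷-injective xs! (words-unique n xs!)

  ∈-words : ∀ {A : Set} {xs : List A} {n} (w : Vec A n) → (∀ i → lookup w i ∈ₗ xs) → w ∈ₗ words xs n
  ∈-words []      _  = here refl
  ∈-words (x ∷ w) w∈ = ∈-cartesianProductWith⁺ _∷_ (w∈ zero) (∈-words w (w∈ ∘ suc))

  DP-unique : ∀ n → Unique (DP n)
  DP-unique n = Unique.filter⁺ isAreaSequence? (words-unique n (Unique.upTo⁺ n))

  ∈-DP : ∀ {n} {a : Vec ℕ n} → IsAreaSequence a → a ∈ₗ DP n
  ∈-DP {n} {a} area = ∈-filter⁺ isAreaSequence?
    (∈-words a (λ i → ∈-upTo⁺ (≤-trans (proj₁ area i) (toℕ<n i)))) area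

  DP⇒area : ∀ {n} {a : Vec ℕ n} → a ∈ₗ DP n → IsAreaSequence a
  DP⇒area {n} a∈ = proj₂ (∈-filter⁻ isAreaSequence? {xs = words (upTo n) n} a∈)

  letters : List Letter
  letters = (true , true) ∷ (true , false) ∷ (false , true) ∷ (false , false) ∷ []

  letters-unique : Unique letters
  letters-unique = toWitness {a? = unique? (≡-dec Bool._≟_ Bool._≟_) letters} _

  ∈-letters : ∀ l → l ∈ₗ letters
  ∈-letters (true  , true)  = here refl
  ∈-letters (true  , false) = there (here refl)
  ∈-letters (false , true)  = there (there (here refl))
  ∈-letters (false , false) = there (there (there (here refl)))

  twins : ∀ {n} → Vec Letter n → ℕ
  twins = count twinned?

  length-filter-lookup : ∀ {n} {P : Pred A ℓ₃} (P? : Decidable P) (v : Vec A n) →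
                         length (filter (P? ∘ lookup v) (allFin n)) ≡ count P? v
  length-filter-lookup P? [] = refl
  length-filter-lookup {n = suc n} P? (x ∷ v) with does (P? x) | rest
    where
    rest : length (filter (P? ∘ lookup (x ∷ v)) (List.tabulate suc)) ≡ count P? v
    rest = begin
      length (filter (P? ∘ lookup (x ∷ v)) (List.tabulate suc))
        ≡⟨ cong (length ∘ filter (P? ∘ lookup (x ∷ v))) (map-tabulate id suc) ⟨
      length (filter (P? ∘ lookup (x ∷ v)) (map suc (allFin n)))
        ≡⟨ cong length (filter-map (P? ∘ lookup (x ∷ v)) suc (allFin n)) ⟩
      length (map suc (filter (P? ∘ lookup v) (allFin n)))
        ≡⟨ length-map suc (filter (P? ∘ lookup v) (allFin n)) ⟩
      length (filter (P? ∘ lookup v) (allFin n))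
        ≡⟨ length-filter-lookup P? v ⟩
      count P? v ∎
      where open ≡-Reasoning
  ... | true  | rest = cong suc rest
  ... | false | rest = rest

  -- Consecutive vertices are the pairs (inject₁ i , suc i), one for each letter of the word.
  twin-path : ∀ {n} (a : Vec ℕ (suc n)) → IsAreaSequence a → twin a ≡ twins (path a)
  twin-path {n} a area = begin
    length (filter twinPair? pairs)                           ≡⟨ ↭.↭-length bijection ⟨
    length (map consecutive (filter twinnedAt? (allFin n)))   ≡⟨ length-map consecutive (filter twinnedAt? (allFin n)) ⟩
    length (filter twinnedAt? (allFin n))                     ≡⟨ length-filter-lookup twinned? (path a) ⟩
    twins (path a)                                            ∎
    where
    open ≡-Reasoning
    open Graph (Γ a) using (TwinPair; twinPair?)
    pairs = cartesianProduct (allFin (suc n)) (allFin (suc n))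
    twinnedAt? = twinned? ∘ lookup (path a)
    consecutive : Fin n → Fin (suc n) × Fin (suc n)
    consecutive i = inject₁ i , suc i
    twinPair⁻ : ∀ {ij} → TwinPair ij → ij ∈ₗ map consecutive (filter twinnedAt? (allFin n))
    twinPair⁻ {i , suc j} tp@(j≡1+i , _) with refl ← toℕ-injective (trans (toℕ-inject₁ j) (suc-injective j≡1+i)) =
      ∈-map⁺ consecutive (∈-filter⁺ twinnedAt? (∈-allFin j) (Equivalence.to (path-twinned⇔ a area j) tp))
    forward : ∀ {ij} → ij ∈ₗ map consecutive (filter twinnedAt? (allFin n)) → ij ∈ₗ filter twinPair? pairs
    forward ij∈ with i , i∈ , refl ← ∈-map⁻ consecutive ij∈ =
      ∈-filter⁺ twinPair? (∈-cartesianProduct⁺ (∈-allFin _) (∈-allFin _))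
        (Equivalence.from (path-twinned⇔ a area i) (proj₂ (∈-filter⁻ twinnedAt? {xs = allFin n} i∈)))
    bijection : map consecutive (filter twinnedAt? (allFin n)) ↭ filter twinPair? pairs
    bijection = ∼bag⇒↭ (unique∧set⇒bag
      (Unique.map⁺ (λ { refl → refl }) (Unique.filter⁺ twinnedAt? (Unique.allFin⁺ n)))
      (Unique.filter⁺ twinPair? (Unique.cartesianProduct⁺ (Unique.allFin⁺ (suc n)) (Unique.allFin⁺ (suc n))))
      (mk⇔ forward (λ ij∈ → twinPair⁻ (proj₂ (∈-filter⁻ twinPair? {xs = pairs} ij∈)))))

  -- Kept as a list, so that one recursion serves both the counts for a fixed k and the sums of
  -- powers of t.
  twinNumbers : ℕ → ℕ → List ℕ
  twinNumbers n h = map twins (filter (balanced? h) (words letters n))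

  map-path-DP : ∀ n → map path (DP (suc n)) ↭ filter (balanced? 0) (words letters n)
  map-path-DP n = map-↭-inverse (DP-unique (suc n))
    (Unique.filter⁺ (balanced? 0) (words-unique n letters-unique)) path areaSequence
    (λ {a} a∈ → let area = DP⇒area a∈ in
      ∈-filter⁺ (balanced? 0) (∈-words (path a) (λ i → ∈-letters _)) (path-balanced a area) ,
      areaSequence-path a area)
    (λ {w} w∈ → let bal = proj₂ (∈-filter⁻ (balanced? 0) {xs = words letters n} w∈) in
      ∈-DP (areaSequence-isAreaSequence w bal) , path-areaSequence w bal)

  map-twin-DP : ∀ n → map twin (DP (suc n)) ↭ twinNumbers n 0
  map-twin-DP n = ↭-trans
    (↭-reflexive (trans (map-cong-local (All.tabulate λ {a} a∈ → twin-path a (DP⇒area a∈))) (map-∘ (DP (suc n)))))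
    (↭.map⁺ twins (map-path-DP n))

  -- The value of `f` one level lower, with `z` at the axis, where no fall is possible.
  afterFall : A → (ℕ → A) → ℕ → A
  afterFall z f zero    = z
  afterFall z f (suc h) = f h

  -- One summand for each first letter, in the order of `letters`: rise, flat step with a twin, flat
  -- step without, fall.
  twinNumbers-suc : ∀ n h → twinNumbers (suc n) h ≡
    twinNumbers n (suc h) ++ map suc (twinNumbers n h) ++ twinNumbers n h ++ afterFall [] (twinNumbers n) h
  twinNumbers-suc n h = begin
    twinNumbers (suc n) h
      ≡⟨ first (true , true) _ ⟩
    twinNumbers n (suc h) ++ _
      ≡⟨ cong (twinNumbers n (suc h) ++_) (first (true , false) _) ⟩
    twinNumbers n (suc h) ++ map (suc ∘ twins) W ++ _
      ≡⟨ cong₂ (λ x y → twinNumbers n (suc h) ++ x ++ y) (map-∘ W) (first (false , true) _) ⟩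
    twinNumbers n (suc h) ++ map suc (twinNumbers n h) ++ twinNumbers n h ++ _
      ≡⟨ cong (λ x → twinNumbers n (suc h) ++ map suc (twinNumbers n h) ++ twinNumbers n h ++ x) (fall h) ⟩
    twinNumbers n (suc h) ++ map suc (twinNumbers n h) ++ twinNumbers n h ++ afterFall [] (twinNumbers n) h ∎
    where
    open ≡-Reasoning
    W = filter (balanced? h) (words letters n)
    first : ∀ {h} l R → map twins (filter (balanced? h) (map (l ∷_) (words letters n) ++ R)) ≡
            map (twins ∘ (l ∷_)) (filter (balanced? h ∘ (l ∷_)) (words letters n)) ++
            map twins (filter (balanced? h) R)
    first {h} l R = begin
      map twins (filter (balanced? h) (map (l ∷_) V ++ R))
        ≡⟨ cong (map twins) (filter-++ (balanced? h) (map (l ∷_) V) R) ⟩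
      map twins (filter (balanced? h) (map (l ∷_) V) ++ filter (balanced? h) R)
        ≡⟨ map-++ twins (filter (balanced? h) (map (l ∷_) V)) (filter (balanced? h) R) ⟩
      map twins (filter (balanced? h) (map (l ∷_) V)) ++ map twins (filter (balanced? h) R)
        ≡⟨ cong (λ x → map twins x ++ map twins (filter (balanced? h) R)) (filter-map (balanced? h) (l ∷_) V) ⟩
      map twins (map (l ∷_) (filter (balanced? h ∘ (l ∷_)) V)) ++ map twins (filter (balanced? h) R)
        ≡⟨ cong (_++ map twins (filter (balanced? h) R)) (map-∘ (filter (balanced? h ∘ (l ∷_)) V)) ⟨
      map (twins ∘ (l ∷_)) (filter (balanced? h ∘ (l ∷_)) V) ++ map twins (filter (balanced? h) R) ∎
      where V = words letters n
    fall : ∀ h → map twins (filter (balanced? h) (map ((false , false) ∷_) (words letters n) ++ [])) ≡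
                 afterFall [] (twinNumbers n) h
    fall zero    = trans (first (false , false) []) (trans (++-identityʳ _)
      (cong (map (twins ∘ ((false , false) ∷_))) (filter-none _ (All.universal (λ _ ()) (words letters n)))))
    fall (suc h) = trans (first (false , false) []) (++-identityʳ _)

  -- Counting the balanced words with k twins

  occurrences : ℕ → List ℕ → ℕ
  occurrences k xs = length (filter (_≟ k) xs)

  occurrences-++ : ∀ k xs ys → occurrences k (xs ++ ys) ≡ occurrences k xs + occurrences k ys
  occurrences-++ k xs ys = trans (cong length (filter-++ (_≟ k) xs ys)) (length-++ (filter (_≟ k) xs))

  occurrences-map-suc : ∀ k xs → occurrences (suc k) (map suc xs) ≡ occurrences k xs
  occurrences-map-suc k []       = refl
  occurrences-map-suc k (x ∷ xs) with x ≡ᵇ k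
  ... | true  = cong suc (occurrences-map-suc k xs)
  ... | false = occurrences-map-suc k xs

  occurrences-zero-map-suc : ∀ xs → occurrences 0 (map suc xs) ≡ 0
  occurrences-zero-map-suc []       = refl
  occurrences-zero-map-suc (x ∷ xs) = occurrences-zero-map-suc xs

  motzkin : ℕ → ℕ → ℕ
  motzkin n h = length (filter (motzkinFrom? h) (words (up ∷ down ∷ flat ∷ []) n))

  motzkin-suc : ∀ n h → motzkin (suc n) h ≡ motzkin n (suc h) + (afterFall 0 (motzkin n) h + motzkin n h)
  motzkin-suc n h = trans (prefix up _) (cong₂ _+_ (filtered-≐ (λ { (up p) → p }) up)
    (trans (prefix down _) (cong₂ _+_ (down-count h) (trans (prefix flat [])
      (trans (+-identityʳ _) (filtered-≐ (λ { (flat p) → p }) flat))))))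
    where
    W = words (up ∷ down ∷ flat ∷ []) n
    prefix : ∀ {h} s R → length (filter (motzkinFrom? h) (map (s ∷_) W ++ R)) ≡
             length (filter (motzkinFrom? h ∘ (s ∷_)) W) + length (filter (motzkinFrom? h) R)
    prefix {h} s R = trans
      (trans (cong length (filter-++ (motzkinFrom? h) (map (s ∷_) W) R)) (length-++ (filter (motzkinFrom? h) (map (s ∷_) W))))
      (cong (_+ length (filter (motzkinFrom? h) R))
        (trans (cong length (filter-map (motzkinFrom? h) (s ∷_) W)) (length-map (s ∷_) (filter (motzkinFrom? h ∘ (s ∷_)) W))))
    filtered-≐ : ∀ {h h′ s} → (∀ {w : Vec Step n} → MotzkinFrom h (s ∷ w) → MotzkinFrom h′ w) →
                 (∀ {w : Vec Step n} → MotzkinFrom h′ w → MotzkinFrom h (s ∷ w)) →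
                 length (filter (motzkinFrom? h ∘ (s ∷_)) W) ≡ motzkin n h′
    filtered-≐ {h} {h′} {s} to from = cong length (filter-≐ (motzkinFrom? h ∘ (s ∷_)) (motzkinFrom? h′) (to , from) W)
    down-count : ∀ h → length (filter (motzkinFrom? h ∘ (down ∷_)) W) ≡ afterFall 0 (motzkin n) h
    down-count zero    = cong length (filter-none (motzkinFrom? 0 ∘ (down ∷_)) (All.universal (λ _ ()) W))
    down-count (suc h) = filtered-≐ (λ { (down p) → p }) down

  twinCount : ℕ → ℕ → ℕ → ℕ
  twinCount k n h = occurrences k (twinNumbers n h)

  twinCount-suc : ∀ k n h → twinCount k (suc n) h ≡
    twinCount k n (suc h) + (occurrences k (map suc (twinNumbers n h)) + (twinCount k n h + afterFall 0 (twinCount k n) h))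
  twinCount-suc k n h = begin
    occurrences k (twinNumbers (suc n) h)
      ≡⟨ cong (occurrences k) (twinNumbers-suc n h) ⟩
    occurrences k (U ++ T ++ L ++ F)
      ≡⟨ occurrences-++ k U (T ++ L ++ F) ⟩
    # U + occurrences k (T ++ L ++ F)
      ≡⟨ cong (λ x → # U + x) (occurrences-++ k T (L ++ F)) ⟩
    # U + (# T + occurrences k (L ++ F))
      ≡⟨ cong (λ x → # U + (# T + x)) (occurrences-++ k L F) ⟩
    # U + (# T + (# L + # F))
      ≡⟨ cong (λ x → # U + (# T + (# L + x))) (fall h) ⟩
    # U + (# T + (# L + afterFall 0 (twinCount k n) h)) ∎
    where
    open ≡-Reasoning
    # = occurrences k
    U = twinNumbers n (suc h)
    T = map suc (twinNumbers n h)
    L = twinNumbers n h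
    F = afterFall [] (twinNumbers n) h
    fall : ∀ h → occurrences k (afterFall [] (twinNumbers n) h) ≡ afterFall 0 (twinCount k n) h
    fall zero    = refl
    fall (suc h) = refl

  afterFall-*ˡ : ∀ c {f g : ℕ → ℕ} → (∀ h → f h ≡ c * g h) → ∀ h → afterFall 0 f h ≡ c * afterFall 0 g h
  afterFall-*ˡ c eq zero    = sym (*-zeroʳ c)
  afterFall-*ˡ c eq (suc h) = eq h

  -- Both sides satisfy the recursion by the first letter. The twin letter supplies the term `n C k`
  -- of Pascal's rule; the other three letters all carry `n C suc k` and reassemble the Motzkin
  -- recursion.
  twinCount-closed : ∀ n k h → twinCount k n h ≡ (n C k) * motzkin (n ∸ k) h
  twinCount-closed zero    zero    zero    = refl
  twinCount-closed zero    zero    (suc h) = refl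
  twinCount-closed zero    (suc k) zero    = refl
  twinCount-closed zero    (suc k) (suc h) = refl
  twinCount-closed (suc n) zero    h = begin
    twinCount 0 (suc n) h
      ≡⟨ twinCount-suc 0 n h ⟩
    twinCount 0 n (suc h) + (occurrences 0 (map suc (twinNumbers n h)) + (twinCount 0 n h + afterFall 0 (twinCount 0 n) h))
      ≡⟨ cong₂ _+_ (twinCount-closed n 0 (suc h)) (cong₂ _+_ (occurrences-zero-map-suc (twinNumbers n h))
           (cong₂ _+_ (twinCount-closed n 0 h) (afterFall-*ˡ 1 (twinCount-closed n 0) h))) ⟩
    1 * motzkin n (suc h) + (0 + (1 * motzkin n h + 1 * afterFall 0 (motzkin n) h))
      ≡⟨ solve 3 (λ x y z → con 1 :* x :+ (con 0 :+ (con 1 :* y :+ con 1 :* z)) := con 1 :* (x :+ (z :+ y))) refl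
           (motzkin n (suc h)) (motzkin n h) (afterFall 0 (motzkin n) h) ⟩
    1 * (motzkin n (suc h) + (afterFall 0 (motzkin n) h + motzkin n h))
      ≡⟨ cong (1 *_) (motzkin-suc n h) ⟨
    1 * motzkin (suc n) h ∎
    where
    open ≡-Reasoning
    open +-*-Solver
  twinCount-closed (suc n) (suc k) h = begin
    twinCount (suc k) (suc n) h
      ≡⟨ twinCount-suc (suc k) n h ⟩
    twinCount (suc k) n (suc h) + (occurrences (suc k) (map suc (twinNumbers n h)) +
      (twinCount (suc k) n h + afterFall 0 (twinCount (suc k) n) h))
      ≡⟨ cong₂ _+_ (twinCount-closed n (suc k) (suc h))
           (cong₂ _+_ (trans (occurrences-map-suc k (twinNumbers n h)) (twinCount-closed n k h))
           (cong₂ _+_ (twinCount-closed n (suc k) h) (afterFall-*ˡ c′ (twinCount-closed n (suc k)) h))) ⟩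
    c′ * m (suc h) + (c * motzkin (n ∸ k) h + (c′ * m h + c′ * afterFall 0 m h))
      ≡⟨ solve 5 (λ c′ x r y z → c′ :* x :+ (r :+ (c′ :* y :+ c′ :* z)) := r :+ c′ :* (x :+ (z :+ y))) refl
           c′ (m (suc h)) (c * motzkin (n ∸ k) h) (m h) (afterFall 0 m h) ⟩
    c * motzkin (n ∸ k) h + c′ * (m (suc h) + (afterFall 0 m h + m h))
      ≡⟨ cong (λ x → c * motzkin (n ∸ k) h + x) first-step ⟩
    c * motzkin (n ∸ k) h + c′ * motzkin (n ∸ k) h
      ≡⟨ *-distribʳ-+ (motzkin (n ∸ k) h) c c′ ⟨
    (c + c′) * motzkin (n ∸ k) h
      ≡⟨ cong (_* motzkin (n ∸ k) h) (nCk+nC[k+1]≡[n+1]C[k+1] n k) ⟩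
    (suc n C suc k) * motzkin (n ∸ k) h ∎
    where
    open ≡-Reasoning
    open +-*-Solver
    c = n C k
    c′ = n C suc k
    m = motzkin (n ∸ suc k)
    -- The Motzkin recursion applies if `n ∸ k` is a successor; otherwise the truncated lengths do
    -- not match, but `c′` is 0.
    first-step : c′ * (m (suc h) + (afterFall 0 m h + m h)) ≡ c′ * motzkin (n ∸ k) h
    first-step with k <? n
    ... | yes k<n = cong (c′ *_) (trans (sym (motzkin-suc (n ∸ suc k) h))
                      (cong (λ j → motzkin j h) (sym (+-∸-assoc 1 k<n))))
    ... | no  k≮n = trans (cong (_* (m (suc h) + (afterFall 0 m h + m h))) c′≡0) (cong (_* motzkin (n ∸ k) h) (sym c′≡0))
      where
      c′≡0 : c′ ≡ 0
      c′≡0 = k>n⇒nCk≡0 (s≤s (≮⇒≥ k≮n))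

  τ-occurrences : ∀ n k → τ n k ≡ occurrences k (map twin (DP n))
  τ-occurrences n k = sym (trans (cong length (filter-map (_≟ k) twin (DP n)))
    (length-map twin (filter (λ a → twin a ≟ k) (DP n))))

  τ-closed : ∀ n k → τ (suc n) k ≡ (n C k) * M (n ∸ k)
  τ-closed n k = begin
    τ (suc n) k                              ≡⟨ τ-occurrences (suc n) k ⟩
    occurrences k (map twin (DP (suc n)))    ≡⟨ ↭.↭-length (↭.filter-↭ (_≟ k) (map-twin-DP n)) ⟩
    twinCount k n 0                          ≡⟨ twinCount-closed n k 0 ⟩
    (n C k) * M (n ∸ k)                      ∎
    where open ≡-Reasoning

  -- Binomial coefficients and ballot numbers

  absorption : ∀ n j → suc j * (n C suc j) ≡ (n ∸ j) * (n C j)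
  absorption zero    zero    = refl
  absorption zero    (suc j) = *-zeroʳ (suc (suc j))
  absorption (suc n) zero    = trans (+-identityʳ _) (trans (nC1≡n (suc n)) (sym (*-identityʳ (suc n))))
  absorption (suc n) (suc j) = begin
    suc (suc j) * (suc n C suc (suc j))
      ≡⟨ cong (suc (suc j) *_) (nCk+nC[k+1]≡[n+1]C[k+1] n (suc j)) ⟨
    suc (suc j) * (b + n C suc (suc j))
      ≡⟨ *-distribˡ-+ (suc (suc j)) b (n C suc (suc j)) ⟩
    suc (suc j) * b + suc (suc j) * (n C suc (suc j))
      ≡⟨ cong (λ x → suc (suc j) * b + x) (absorption n (suc j)) ⟩
    suc (suc j) * b + (n ∸ suc j) * b
      ≡⟨ solve 3 (λ j b m → (con 2 :+ j) :* b :+ m :* b := (con 1 :+ j) :* b :+ (con 1 :+ m) :* b) refl j b (n ∸ suc j) ⟩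
    suc j * b + suc (n ∸ suc j) * b
      ≡⟨ cong₂ _+_ (absorption n j) recover ⟩
    (n ∸ j) * (n C j) + (n ∸ j) * b
      ≡⟨ *-distribˡ-+ (n ∸ j) (n C j) b ⟨
    (n ∸ j) * (n C j + b)
      ≡⟨ cong ((n ∸ j) *_) (nCk+nC[k+1]≡[n+1]C[k+1] n j) ⟩
    (n ∸ j) * (suc n C suc j) ∎
    where
    open ≡-Reasoning
    open +-*-Solver
    b = n C suc j
    -- For `j ≥ n` the truncation makes the first factors differ, but then `b` is 0.
    recover : suc (n ∸ suc j) * b ≡ (n ∸ j) * b
    recover with j <? n
    ... | yes j<n = cong (_* b) (sym (+-∸-assoc 1 j<n))
    ... | no  j≮n rewrite k>n⇒nCk≡0 (s≤s (≮⇒≥ j≮n)) = trans (*-zeroʳ (suc (n ∸ suc j))) (sym (*-zeroʳ (n ∸ j)))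

  -- For `k > n` both sides vanish, so the terms beyond the end of the hypergeometric series need no
  -- separate treatment.
  nCk*k!≡nP′k : ∀ n k → (n C k) * k ! ≡ n P′ k
  nCk*k!≡nP′k n zero    = refl
  nCk*k!≡nP′k n (suc k) = begin
    (n C suc k) * (suc k * k !)    ≡⟨ solve 3 (λ c k f → c :* (k :* f) := k :* c :* f) refl (n C suc k) (suc k) (k !) ⟩
    suc k * (n C suc k) * k !      ≡⟨ cong (_* k !) (absorption n k) ⟩
    (n ∸ k) * (n C k) * k !        ≡⟨ *-assoc (n ∸ k) (n C k) (k !) ⟩
    (n ∸ k) * ((n C k) * k !)      ≡⟨ cong ((n ∸ k) *_) (nCk*k!≡nP′k n k) ⟩
    (n ∸ k) * (n P′ k)             ∎
    where
    open ≡-Reasoning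
    open +-*-Solver

  -- The number of paths with i steps ±1 from height h to height 0 that stay weakly above 0.
  ballot : ℕ → ℕ → ℕ
  ballot zero    zero    = 1
  ballot zero    (suc h) = 0
  ballot (suc i) h       = ballot i (suc h) + afterFall 0 (ballot i) h

  ballot-beyond : ∀ {i h} → i < h → ballot i h ≡ 0
  ballot-beyond {zero}  {suc h} _   = refl
  ballot-beyond {suc i} {suc h} i<h = cong₂ _+_
    (ballot-beyond {i} {suc (suc h)} (m≤n⇒m≤1+n (<⇒≤ i<h))) (ballot-beyond {i} {h} (s≤s⁻¹ i<h))

  -- A step lowers i by one and changes h by one, so the parity of i + h is invariant, and it is
  -- even at the end.
  ballot-odd : ∀ j i h → i + h ≡ suc (j * 2) → ballot i h ≡ 0
  ballot-odd j zero    (suc h) _ = refl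
  ballot-odd j (suc i) zero    eq = trans (+-identityʳ _) (ballot-odd j i 1 (trans (+-suc i 0) eq))
  ballot-odd zero (suc zero) (suc h) ()
  ballot-odd zero (suc (suc i)) (suc h) ()
  ballot-odd (suc j) (suc i) (suc h) eq = cong₂ _+_
    (ballot-odd (suc j) i (suc (suc h)) (trans (+-suc i (suc h)) eq))
    (ballot-odd j i h (suc-injective (suc-injective (trans (cong suc (sym (+-suc i h))) eq))))

  -- The ballot number (h + 1) i! / (j! (h + j + 1)!) with denominators cleared, where j is the
  -- number of steps up. At h = 0 it is the Catalan number Catⱼ.
  ballot-closed : ∀ i h j → i ≡ h + j * 2 → ballot i h * (j ! * (suc (h + j)) !) ≡ suc h * i !
  ballot-closed zero zero zero _ = refl
  ballot-closed (suc i) zero (suc j) eq = begin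
    (ballot i 1 + 0) * ((suc j * j !) * (2 + j) !)
      ≡⟨ solve 4 (λ b j f g → (b :+ con 0) :* ((j :* f) :* g) := j :* (b :* (f :* g))) refl (ballot i 1) (suc j) (j !) ((2 + j) !) ⟩
    suc j * (ballot i 1 * (j ! * (2 + j) !))
      ≡⟨ cong (suc j *_) (ballot-closed i 1 j (suc-injective eq)) ⟩
    suc j * (2 * i !)
      ≡⟨ solve 2 (λ j f → (con 1 :+ j) :* (con 2 :* f) := con 1 :* ((con 2 :+ j :* con 2) :* f)) refl j (i !) ⟩
    1 * (suc (suc (j * 2)) * i !)
      ≡⟨ cong (λ m → 1 * (m * i !)) eq ⟨
    1 * (suc i * i !) ∎
    where
    open ≡-Reasoning
    open +-*-Solver
  -- There are only as many steps left as the height, so a step up could not be made good.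
  ballot-closed (suc i) (suc h) zero eq = begin
    (ballot i (suc (suc h)) + ballot i h) * (1 * ((suc (suc (h + 0))) * (suc (h + 0)) !))
      ≡⟨ cong (λ b → (b + ballot i h) * (1 * ((suc (suc (h + 0))) * (suc (h + 0)) !)))
           (ballot-beyond (≤-trans (s≤s (≤-reflexive (trans (suc-injective eq) (+-identityʳ h)))) (n≤1+n (suc h)))) ⟩
    ballot i h * (1 * ((suc (suc (h + 0))) * (suc (h + 0)) !))
      ≡⟨ solve 3 (λ b h f → b :* (con 1 :* (h :* f)) := h :* (b :* (con 1 :* f))) refl (ballot i h) (suc (suc (h + 0))) ((suc (h + 0)) !) ⟩
    suc (suc (h + 0)) * (ballot i h * (1 * (suc (h + 0)) !))
      ≡⟨ cong₂ _*_ (cong (λ m → suc (suc m)) (+-identityʳ h)) (ballot-closed i h 0 (suc-injective eq)) ⟩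
    suc (suc h) * (suc h * i !)
      ≡⟨ cong (λ m → suc (suc h) * (suc m * i !)) (trans (suc-injective eq) (+-identityʳ h)) ⟨
    suc (suc h) * (suc i * i !) ∎
    where
    open ≡-Reasoning
    open +-*-Solver
  ballot-closed (suc i) (suc h) (suc j) eq = begin
    (p + q) * ((suc j * j !) * (suc (suc h + suc j)) !)
      ≡⟨ cong (λ m → (p + q) * ((suc j * j !) * (suc (suc m)) !)) (+-suc h j) ⟩
    (p + q) * ((suc j * j !) * (suc (suc (suc (h + j))) * f))
      ≡⟨ solve 6 (λ p q j g m f → (p :+ q) :* ((j :* g) :* (m :* f)) :=
                                  j :* (p :* (g :* (m :* f))) :+ m :* (q :* ((j :* g) :* f)))
           refl p q (suc j) (j !) (suc (suc (suc (h + j)))) f ⟩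
    suc j * (p * (j ! * (suc (suc (suc (h + j))) * f))) + suc (suc (suc (h + j))) * (q * ((suc j * j !) * f))
      ≡⟨ cong₂ (λ x y → suc j * x + suc (suc (suc (h + j))) * y)
           (ballot-closed i (suc (suc h)) j (trans i≡ (trans (+-suc h (suc (j * 2))) (cong suc (+-suc h (j * 2))))))
           (trans (cong (λ m → q * ((suc j * j !) * (suc m) !)) (sym (+-suc h j))) (ballot-closed i h (suc j) i≡)) ⟩
    suc j * ((3 + h) * i !) + suc (suc (suc (h + j))) * (suc h * i !)
      ≡⟨ solve 3 (λ h j g → (con 1 :+ j) :* ((con 3 :+ h) :* g) :+ (con 3 :+ (h :+ j)) :* ((con 1 :+ h) :* g) :=
                            (con 2 :+ h) :* ((con 1 :+ (h :+ (con 2 :+ j :* con 2))) :* g)) refl h j (i !) ⟩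
    suc (suc h) * (suc (h + suc j * 2) * i !)
      ≡⟨ cong (λ m → suc (suc h) * (suc m * i !)) i≡ ⟨
    suc (suc h) * (suc i * i !) ∎
    where
    open ≡-Reasoning
    open +-*-Solver
    p = ballot i (suc (suc h))
    q = ballot i h
    f = (suc (suc (h + j))) !
    i≡ : i ≡ h + suc j * 2
    i≡ = suc-injective eq

open TwinCounting

-- The hypergeometric coefficients in ℚ

module HypergeometricCoefficients where

  open import Data.Integer.Base using (ℤ)
  import Data.Integer.Properties as ℤ
  open import Data.Nat.Base as ℕ using (zero; _!)
  open import Data.Nat.Combinatorics.Base using (_P′_)
  import Data.Nat.Properties as ℕ
  open import Data.Rational.Base using (_+_; -_; _-_; 1/_; 1ℚ; toℚᵘ)
  import Data.Rational.Properties as ℚ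
  import Data.Rational.Unnormalised.Base as ℚᵘ
  import Data.Rational.Unnormalised.Properties as ℚᵘ
  open import Data.Rational.Solver using (module +-*-Solver)
  open import Relation.Binary.PropositionalEquality
  open import Relation.Nullary.Decidable using (yes; no)

  -- `ℚ./` reduces by a gcd and is stuck on variables, so identities between fractions are checked
  -- on unnormalised ones.
  toℚᵘ-/ : ∀ p d .{{_ : ℕ.NonZero d}} → toℚᵘ (p ℚ./ d) ℚᵘ.≃ p ℚᵘ./ d
  toℚᵘ-/ p (suc d) = ℚ.toℚᵘ-fromℚᵘ (ℚᵘ.mkℚᵘ p d)

  /1-+ : ∀ p q → (p ℤ.+ q) ℚ./ 1 ≡ p ℚ./ 1 + q ℚ./ 1
  /1-+ p q = ℚ.toℚᵘ-injective (begin
    toℚᵘ ((p ℤ.+ q) ℚ./ 1)                ≈⟨ toℚᵘ-/ (p ℤ.+ q) 1 ⟩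
    (p ℤ.+ q) ℚᵘ./ 1                      ≈⟨ ℚᵘ.*≡* (cong (ℤ._* + 1)
      (cong₂ ℤ._+_ (sym (ℤ.*-identityʳ p)) (sym (ℤ.*-identityʳ q)))) ⟩
    p ℚᵘ./ 1 ℚᵘ.+ q ℚᵘ./ 1                ≈⟨ ℚᵘ.+-cong (toℚᵘ-/ p 1) (toℚᵘ-/ q 1) ⟨
    toℚᵘ (p ℚ./ 1) ℚᵘ.+ toℚᵘ (q ℚ./ 1)    ≈⟨ ℚ.toℚᵘ-homo-+ (p ℚ./ 1) (q ℚ./ 1) ⟨
    toℚᵘ (p ℚ./ 1 + q ℚ./ 1)              ∎)
    where open ℚᵘ.≃-Reasoning

  /1-* : ∀ p q → (p ℤ.* q) ℚ./ 1 ≡ (p ℚ./ 1) ℚ.* (q ℚ./ 1)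
  /1-* p q = ℚ.toℚᵘ-injective (begin
    toℚᵘ ((p ℤ.* q) ℚ./ 1)                ≈⟨ toℚᵘ-/ (p ℤ.* q) 1 ⟩
    (p ℚᵘ./ 1) ℚᵘ.* (q ℚᵘ./ 1)              ≈⟨ ℚᵘ.*-cong (toℚᵘ-/ p 1) (toℚᵘ-/ q 1) ⟨
    toℚᵘ (p ℚ./ 1) ℚᵘ.* toℚᵘ (q ℚ./ 1)    ≈⟨ ℚ.toℚᵘ-homo-* (p ℚ./ 1) (q ℚ./ 1) ⟨
    toℚᵘ ((p ℚ./ 1) ℚ.* (q ℚ./ 1))              ∎)
    where open ℚᵘ.≃-Reasoning

  /-*-cancel : ∀ p d .{{_ : ℕ.NonZero d}} → p ℚ./ d ℚ.* ℕ→ℚ d ≡ p ℚ./ 1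
  /-*-cancel p d@(suc d-1) = ℚ.toℚᵘ-injective (begin
    toℚᵘ (p ℚ./ d ℚ.* ℕ→ℚ d)             ≈⟨ ℚ.toℚᵘ-homo-* (p ℚ./ d) (ℕ→ℚ d) ⟩
    toℚᵘ (p ℚ./ d) ℚᵘ.* toℚᵘ (ℕ→ℚ d)   ≈⟨ ℚᵘ.*-cong (toℚᵘ-/ p d) (toℚᵘ-/ (+ d) 1) ⟩
    (p ℚᵘ./ d) ℚᵘ.* (+ d ℚᵘ./ 1)         ≈⟨ ℚᵘ.*≡* (trans (ℤ.*-assoc p (+ d) (+ 1))
      (cong (p ℤ.*_) (trans (ℤ.*-identityʳ (+ d)) (cong +_ (sym (ℕ.*-identityʳ d)))))) ⟩
    p ℚᵘ./ 1                           ≈⟨ toℚᵘ-/ p 1 ⟨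
    toℚᵘ (p ℚ./ 1)                     ∎)
    where
    open ℚᵘ.≃-Reasoning

  ℕ→ℚ-+ : ∀ m n → ℕ→ℚ (m ℕ.+ n) ≡ ℕ→ℚ m + ℕ→ℚ n
  ℕ→ℚ-+ m n = /1-+ (+ m) (+ n)

  ℕ→ℚ-* : ∀ m n → ℕ→ℚ (m ℕ.* n) ≡ ℕ→ℚ m ℚ.* ℕ→ℚ n
  ℕ→ℚ-* m n = trans (cong (ℚ._/ 1) (ℤ.pos-* m n)) (/1-* (+ m) (+ n))

  ℕ→ℚ-∸ : ∀ {m n} → n ≤ m → ℕ→ℚ (m ∸ n) ≡ ℕ→ℚ m - ℕ→ℚ n
  ℕ→ℚ-∸ {m} {n} n≤m = begin
    ℕ→ℚ (m ∸ n)                          ≡⟨ solve 2 (λ x y → x := (x :+ y) :- y) refl (ℕ→ℚ (m ∸ n)) (ℕ→ℚ n) ⟩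
    ℕ→ℚ (m ∸ n) + ℕ→ℚ n - ℕ→ℚ n          ≡⟨ cong (_- ℕ→ℚ n) (ℕ→ℚ-+ (m ∸ n) n) ⟨
    ℕ→ℚ (m ∸ n ℕ.+ n) - ℕ→ℚ n            ≡⟨ cong (λ k → ℕ→ℚ k - ℕ→ℚ n) (ℕ.m∸n+n≡m n≤m) ⟩
    ℕ→ℚ m - ℕ→ℚ n                        ∎
    where
    open ≡-Reasoning
    open +-*-Solver

  P′-beyond : ∀ {n k} → n < k → n P′ k ≡ 0
  P′-beyond {n} {suc k} n<1+k with n ℕ.<? k
  ... | yes n<k = trans (cong ((n ∸ k) ℕ.*_) (P′-beyond n<k)) (ℕ.*-zeroʳ (n ∸ k))
  ... | no  n≮k = cong (ℕ._* (n P′ k)) (ℕ.m≤n⇒m∸n≡0 (ℕ.s≤s⁻¹ n<1+k))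

  -- For `k > n` the truncated factor and the true difference disagree, but `n P′ k` is already 0.
  ℕ→ℚ-P′-suc : ∀ n k → ℕ→ℚ (n P′ suc k) ≡ (ℕ→ℚ n - ℕ→ℚ k) ℚ.* ℕ→ℚ (n P′ k)
  ℕ→ℚ-P′-suc n k with k ℕ.≤? n
  ... | yes k≤n = trans (ℕ→ℚ-* (n ∸ k) (n P′ k)) (cong (ℚ._* ℕ→ℚ (n P′ k)) (ℕ→ℚ-∸ k≤n))
  ... | no  k≰n rewrite P′-beyond (ℕ.≰⇒> k≰n) =
    trans (cong ℕ→ℚ (ℕ.*-zeroʳ (n ∸ k))) (sym (ℚ.*-zeroʳ (ℕ→ℚ n - ℕ→ℚ k)))

  -- The factors (a + i)(b + i) · 4 with 2a = − n and 2b = 1 − n are (n − 2i)(n − 2i − 1).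
  pochhammer-halves : ∀ n {a b} → a ℚ.* 2ℚ ≡ - ℕ→ℚ n → b ℚ.* 2ℚ ≡ 1ℚ - ℕ→ℚ n → ∀ i →
    pochhammer a i ℚ.* pochhammer b i ℚ.* ℕ→ℚ (4 ℕ.^ i) ≡ ℕ→ℚ (n P′ (i ℕ.* 2))
  pochhammer-halves n {a} {b} 2a 2b zero    = refl
  pochhammer-halves n {a} {b} 2a 2b (suc i) = begin
    (pa ℚ.* (a + I)) ℚ.* (pb ℚ.* (b + I)) ℚ.* ℕ→ℚ (4 ℕ.* 4 ℕ.^ i)
      ≡⟨ cong ((pa ℚ.* (a + I)) ℚ.* (pb ℚ.* (b + I)) ℚ.*_) (trans (ℕ→ℚ-* 4 (4 ℕ.^ i)) (cong (ℚ._* F) (ℕ→ℚ-* 2 2))) ⟩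
    (pa ℚ.* (a + I)) ℚ.* (pb ℚ.* (b + I)) ℚ.* (2ℚ ℚ.* 2ℚ ℚ.* F)
      ≡⟨ solve 7 (λ pa pb a b I t F → (pa :* (a :+ I)) :* (pb :* (b :+ I)) :* (t :* t :* F) :=
           (b :* t :+ I :* t) :* ((a :* t :+ I :* t) :* (pa :* pb :* F))) refl pa pb a b I 2ℚ F ⟩
    (b ℚ.* 2ℚ + I ℚ.* 2ℚ) ℚ.* ((a ℚ.* 2ℚ + I ℚ.* 2ℚ) ℚ.* (pa ℚ.* pb ℚ.* F))
      ≡⟨ cong₂ (λ x y → (x + I ℚ.* 2ℚ) ℚ.* y) 2b (cong₂ (λ x y → (x + I ℚ.* 2ℚ) ℚ.* y) 2a (pochhammer-halves n 2a 2b i)) ⟩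
    (1ℚ - N + I ℚ.* 2ℚ) ℚ.* ((- N + I ℚ.* 2ℚ) ℚ.* P)
      ≡⟨ solve 5 (λ o N I t P → (o :- N :+ I :* t) :* ((:- N :+ I :* t) :* P) :=
           (N :- (o :+ I :* t)) :* ((N :- I :* t) :* P)) refl 1ℚ N I 2ℚ P ⟩
    (N - (1ℚ + I ℚ.* 2ℚ)) ℚ.* ((N - I ℚ.* 2ℚ) ℚ.* P)
      ≡⟨ cong (λ x → (N - (1ℚ + x)) ℚ.* ((N - x) ℚ.* P)) (ℕ→ℚ-* i 2) ⟨
    (N - (1ℚ + ℕ→ℚ (i ℕ.* 2))) ℚ.* ((N - ℕ→ℚ (i ℕ.* 2)) ℚ.* P)
      ≡⟨ cong₂ (λ x y → (N - x) ℚ.* y) (ℕ→ℚ-+ 1 (i ℕ.* 2)) (ℕ→ℚ-P′-suc n (i ℕ.* 2)) ⟨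
    (N - ℕ→ℚ (suc (i ℕ.* 2))) ℚ.* ℕ→ℚ (n P′ suc (i ℕ.* 2))
      ≡⟨ ℕ→ℚ-P′-suc n (suc (i ℕ.* 2)) ⟨
    ℕ→ℚ (n P′ (suc i ℕ.* 2)) ∎
    where
    open ≡-Reasoning
    open +-*-Solver
    N = ℕ→ℚ n
    I = ℕ→ℚ i
    F = ℕ→ℚ (4 ℕ.^ i)
    P = ℕ→ℚ (n P′ (i ℕ.* 2))
    pa = pochhammer a i
    pb = pochhammer b i

  pochhammer-2 : ∀ i → pochhammer 2ℚ i ≡ ℕ→ℚ (suc i !)
  pochhammer-2 zero    = refl
  pochhammer-2 (suc i) = begin
    pochhammer 2ℚ i ℚ.* (2ℚ + ℕ→ℚ i)        ≡⟨ cong₂ ℚ._*_ (pochhammer-2 i) (sym (ℕ→ℚ-+ 2 i)) ⟩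
    ℕ→ℚ (suc i !) ℚ.* ℕ→ℚ (suc (suc i))     ≡⟨ ℚ.*-comm (ℕ→ℚ (suc i !)) (ℕ→ℚ (suc (suc i))) ⟩
    ℕ→ℚ (suc (suc i)) ℚ.* ℕ→ℚ (suc i !)     ≡⟨ ℕ→ℚ-* (suc (suc i)) (suc i !) ⟨
    ℕ→ℚ (suc (suc i) !)                   ∎
    where open ≡-Reasoning

  -- The powers of 4 come from the argument 4/(1+t)² and clear the halves in the parameters. The
  -- numerator becomes the falling factorial with 2i factors, that is the binomial coefficient times
  -- (2i)!, and (2i)! divided by i! (i+1)! is a Catalan number.
  ₂F₁-coeff-ballot : ∀ n {a b} → a ℚ.* 2ℚ ≡ - ℕ→ℚ n → b ℚ.* 2ℚ ≡ 1ℚ - ℕ→ℚ n → ∀ i →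
    ₂F₁-coeff a b 2ℚ 2-admissible i ℚ.* ℕ→ℚ (4 ℕ.^ i) ≡ ℕ→ℚ ((n C (i ℕ.* 2)) ℕ.* ballot (i ℕ.* 2) 0)
  ₂F₁-coeff-ballot n {a} {b} 2a 2b i = begin
    pa ℚ.* pb ℚ.* p2⁻¹ ℚ.* f⁻¹ ℚ.* F
      ≡⟨ solve 5 (λ pa pb x y F → pa :* pb :* x :* y :* F := pa :* pb :* F :* (x :* y)) refl pa pb p2⁻¹ f⁻¹ F ⟩
    pa ℚ.* pb ℚ.* F ℚ.* (p2⁻¹ ℚ.* f⁻¹)
      ≡⟨ cong (ℚ._* (p2⁻¹ ℚ.* f⁻¹)) (pochhammer-halves n 2a 2b i) ⟩
    ℕ→ℚ (n P′ (i ℕ.* 2)) ℚ.* (p2⁻¹ ℚ.* f⁻¹)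
      ≡⟨ cong (λ m → ℕ→ℚ m ℚ.* (p2⁻¹ ℚ.* f⁻¹)) numerator ⟨
    ℕ→ℚ (k ℕ.* (i ! ℕ.* suc i !)) ℚ.* (p2⁻¹ ℚ.* f⁻¹)
      ≡⟨ cong (ℚ._* (p2⁻¹ ℚ.* f⁻¹)) (trans (ℕ→ℚ-* k (i ! ℕ.* suc i !)) (cong (ℕ→ℚ k ℚ.*_) (ℕ→ℚ-* (i !) (suc i !)))) ⟩
    ℕ→ℚ k ℚ.* (ℕ→ℚ (i !) ℚ.* ℕ→ℚ (suc i !)) ℚ.* (p2⁻¹ ℚ.* f⁻¹)
      ≡⟨ cong (λ x → ℕ→ℚ k ℚ.* (ℕ→ℚ (i !) ℚ.* x) ℚ.* (p2⁻¹ ℚ.* f⁻¹)) (pochhammer-2 i) ⟨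
    ℕ→ℚ k ℚ.* (ℕ→ℚ (i !) ℚ.* p2) ℚ.* (p2⁻¹ ℚ.* f⁻¹)
      ≡⟨ solve 5 (λ k f p x y → k :* (f :* p) :* (x :* y) := k :* ((p :* x) :* (y :* f))) refl (ℕ→ℚ k) (ℕ→ℚ (i !)) p2 p2⁻¹ f⁻¹ ⟩
    ℕ→ℚ k ℚ.* ((p2 ℚ.* p2⁻¹) ℚ.* (f⁻¹ ℚ.* ℕ→ℚ (i !)))
      ≡⟨ cong₂ (λ x y → ℕ→ℚ k ℚ.* (x ℚ.* y)) (ℚ.*-inverseʳ p2) (/-*-cancel (+ 1) (i !)) ⟩
    ℕ→ℚ k ℚ.* (1ℚ ℚ.* 1ℚ)
      ≡⟨ ℚ.*-identityʳ (ℕ→ℚ k) ⟩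
    ℕ→ℚ k ∎
    where
    open ≡-Reasoning
    open +-*-Solver
    instance
      _ = 2-admissible i
      _ = i ℕ.!≢0
    k = (n C (i ℕ.* 2)) ℕ.* ballot (i ℕ.* 2) 0
    F = ℕ→ℚ (4 ℕ.^ i)
    pa = pochhammer a i
    pb = pochhammer b i
    p2 = pochhammer 2ℚ i
    p2⁻¹ = 1/ p2
    f⁻¹ = + 1 ℚ./ (i !)
    numerator : k ℕ.* (i ! ℕ.* suc i !) ≡ n P′ (i ℕ.* 2)
    numerator = begin
      (n C (i ℕ.* 2)) ℕ.* ballot (i ℕ.* 2) 0 ℕ.* (i ! ℕ.* suc i !)
        ≡⟨ ℕ.*-assoc (n C (i ℕ.* 2)) (ballot (i ℕ.* 2) 0) (i ! ℕ.* suc i !) ⟩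
      (n C (i ℕ.* 2)) ℕ.* (ballot (i ℕ.* 2) 0 ℕ.* (i ! ℕ.* suc i !))
        ≡⟨ cong ((n C (i ℕ.* 2)) ℕ.*_) (trans (ballot-closed (i ℕ.* 2) 0 i refl) (ℕ.*-identityˡ ((i ℕ.* 2) !))) ⟩
      (n C (i ℕ.* 2)) ℕ.* (i ℕ.* 2) !
        ≡⟨ nCk*k!≡nP′k n (i ℕ.* 2) ⟩
      n P′ (i ℕ.* 2) ∎

  first-parameter : ∀ n → (- ((+ suc n ℤ.- + 1) ℚ./ 2)) ℚ.* 2ℚ ≡ - ℕ→ℚ n
  first-parameter n = trans (sym (ℚ.neg-distribˡ-* ((+ n) ℚ./ 2) 2ℚ)) (cong -_ (/-*-cancel (+ n) 2))

  second-parameter : ∀ n → ((+ 2 ℤ.- + suc n) ℚ./ 2) ℚ.* 2ℚ ≡ 1ℚ - ℕ→ℚ n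
  second-parameter n = begin
    ((+ 2 ℤ.- + suc n) ℚ./ 2) ℚ.* 2ℚ    ≡⟨ /-*-cancel (+ 2 ℤ.- + suc n) 2 ⟩
    (+ 2 ℤ.- + suc n) ℚ./ 1           ≡⟨ solve 2 (λ x y → x := (x :+ y) :- y) refl ((+ 2 ℤ.- + suc n) ℚ./ 1) (ℕ→ℚ n) ⟩
    (+ 2 ℤ.- + suc n) ℚ./ 1 + ℕ→ℚ n - ℕ→ℚ n  ≡⟨ cong (_- ℕ→ℚ n) (/1-+ (+ 2 ℤ.- + suc n) (+ n)) ⟨
    ((+ 2 ℤ.- + suc n) ℤ.+ + n) ℚ./ 1 - ℕ→ℚ n   ≡⟨ cong (λ z → z ℚ./ 1 - ℕ→ℚ n) cancel ⟩
    1ℚ - ℕ→ℚ n                        ∎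
    where
    open ≡-Reasoning
    open +-*-Solver
    cancel : (+ 2 ℤ.- + suc n) ℤ.+ + n ≡ + 1
    cancel = trans (cong (ℤ._+ + n) (trans (ℤ.m-n≡m⊖n 2 (suc n)) (trans (ℤ.[1+m]⊖[1+n]≡m⊖n 1 n) (sym (ℤ.m-n≡m⊖n 1 n))))) 
      (trans (ℤ.+-assoc (+ 1) (ℤ.- + n) (+ n)) (cong (λ z → + 1 ℤ.+ z) (ℤ.+-inverseˡ (+ n))))

open HypergeometricCoefficients

open import Data.Fin.Base using (Fin; zero; suc)
open import Data.List.Base using (List; []; _∷_; _++_; map; foldr)
open import Data.List.Properties using (map-∘)
open import Data.List.Relation.Binary.Permutation.Propositional using (_↭_; ↭⇒↭ₛ′)
import Data.List.Relation.Binary.Permutation.Propositional.Properties as ↭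
import Data.List.Relation.Binary.Permutation.Setoid.Properties as ↭ₛ
open import Data.List.Relation.Unary.All as All using (All; []; _∷_)
import Data.List.Relation.Unary.All.Properties as All
open import Data.Nat.Base as ℕ using (zero; z≤n; s≤s; s≤s⁻¹)
open import Data.Nat.Combinatorics using (nCk+nC[k+1]≡[n+1]C[k+1])
import Data.Nat.Properties as ℕ
open import Data.Product.Base using (_,_)
open import Data.Vec.Properties using (count≤n)
open import Function.Base using (_∘_)
open import Relation.Binary.PropositionalEquality as ≡ using ()

-- The generating polynomial as a sum over twin numbers

twin-bounded : ∀ n → All (_< suc n) (map twin (DP n))
twin-bounded zero    = s≤s z≤n ∷ []
twin-bounded (suc n) = All.map⁺ (All.tabulate λ {a} a∈ →
  ≡.subst (_< suc (suc n)) (≡.sym (twin-path a (DP⇒area a∈))) (s≤s (ℕ.m≤n⇒m≤1+n (count≤n twinned? (path a)))))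

module _ {r ℓ} (R : CommutativeRing r ℓ) where
  open CommutativeRing R hiding (_+_; _*_)
  open RingNotation R using (_⊕_; _⊛_; _^_; _·_; sum-syntax; sum⁺-syntax)
  open import Algebra.Properties.CommutativeMonoid.Sum +-commutativeMonoid using (sum; sum-cong-≋; ∑-distrib-+; sum-replicate-zero)
  open import Algebra.Properties.Semiring.Sum semiring using (*-distribˡ-sum)
  open import Algebra.Properties.Semiring.Mult semiring using (×-congʳ; ×-congˡ; ×-homo-+; ×-homo-1; ×-comm-*; ×-assoc-*; ×-assocˡ)
  open import Algebra.Properties.Semiring.Exp semiring using (^-congˡ; ^-assocʳ)
  open import Algebra.Properties.CommutativeSemiring.Exp commutativeSemiring using (^-distrib-*)
  open import Algebra.Solver.Ring.NaturalCoefficients.Default commutativeSemiring using (solve; _:=_; _:+_; _:*_)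
  open import Relation.Binary.Reasoning.Setoid setoid

  sum-cong : ∀ {n} {f g : Fin n → Carrier} → (∀ i → f i ≈ g i) → sum f ≈ sum g
  sum-cong f≈g = sum-cong-≋ f≈g

  sum-zero : ∀ {n} {f : Fin n → Carrier} → (∀ i → f i ≈ 0#) → sum f ≈ 0#
  sum-zero {n} f≈0 = trans (sum-cong f≈0) (sum-replicate-zero n)

  powerSum : Carrier → List ℕ → Carrier
  powerSum t xs = foldr _⊕_ 0# (map (t ^_) xs)

  powerSum-↭ : ∀ t {xs ys} → xs ↭ ys → powerSum t xs ≈ powerSum t ys
  powerSum-↭ t xs↭ys = ↭ₛ.foldr-commMonoid setoid +-isCommutativeMonoid
    (↭⇒↭ₛ′ isEquivalence (↭.map⁺ (t ^_) xs↭ys))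

  powerSum-++ : ∀ t xs ys → powerSum t (xs ++ ys) ≈ powerSum t xs ⊕ powerSum t ys
  powerSum-++ t []       ys = sym (+-identityˡ _)
  powerSum-++ t (x ∷ xs) ys = trans (+-congˡ (powerSum-++ t xs ys)) (sym (+-assoc _ _ _))

  powerSum-map-suc : ∀ t xs → powerSum t (map suc xs) ≈ t ⊛ powerSum t xs
  powerSum-map-suc t []       = sym (zeroʳ t)
  powerSum-map-suc t (x ∷ xs) = trans (+-congˡ (powerSum-map-suc t xs)) (sym (distribˡ t _ _))

  twinPoly-powerSum : ∀ n t → twinPoly R n t ≡ powerSum t (map twin (DP n))
  twinPoly-powerSum n t = ≡.cong (foldr _⊕_ 0#) (map-∘ (DP n))

  -- The occurrences in a one-element list are the indicator of `x`; `g` is arbitrary so that the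
  -- induction can shift it.
  sum-occurrences-[] : ∀ m {x} (g : ℕ → Carrier) → x < m →
                       ∑[ k < m ] (occurrences (toℕ k) (x ∷ []) · g (toℕ k)) ≈ g x
  sum-occurrences-[] (suc m) {zero} g _ = begin
    (g 0 ⊕ 0#) ⊕ ∑[ k < m ] (0 · g (suc (toℕ k)))  ≈⟨ +-cong (+-identityʳ (g 0)) (sum-zero {m} (λ _ → refl)) ⟩
    g 0 ⊕ 0#                                        ≈⟨ +-identityʳ (g 0) ⟩
    g 0                                             ∎
  sum-occurrences-[] (suc m) {suc x} g x<m = begin
    0# ⊕ ∑[ k < m ] (occurrences (suc (toℕ k)) (suc x ∷ []) · g (suc (toℕ k)))
      ≈⟨ +-identityˡ _ ⟩
    ∑[ k < m ] (occurrences (suc (toℕ k)) (suc x ∷ []) · g (suc (toℕ k)))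
      ≈⟨ sum-cong {m} (λ k → ×-congˡ (occurrences-map-suc (toℕ k) (x ∷ []))) ⟩
    ∑[ k < m ] (occurrences (toℕ k) (x ∷ []) · g (suc (toℕ k)))
      ≈⟨ sum-occurrences-[] m (g ∘ suc) (s≤s⁻¹ x<m) ⟩
    g (suc x) ∎

  powerSum-occurrences : ∀ t m xs → All (_< m) xs →
                         powerSum t xs ≈ ∑[ k < m ] (occurrences (toℕ k) xs · t ^ toℕ k)
  powerSum-occurrences t m []       []           = sym (sum-zero {m} (λ _ → refl))
  powerSum-occurrences t m (x ∷ xs) (x<m ∷ xs<m) = begin
    t ^ x ⊕ powerSum t xs
      ≈⟨ +-cong (sym (sum-occurrences-[] m (t ^_) x<m)) (powerSum-occurrences t m xs xs<m) ⟩
    ∑[ k < m ] (occurrences (toℕ k) (x ∷ []) · t ^ toℕ k) ⊕ ∑[ k < m ] (occurrences (toℕ k) xs · t ^ toℕ k)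
      ≈⟨ ∑-distrib-+ {m} _ _ ⟨
    ∑[ k < m ] (occurrences (toℕ k) (x ∷ []) · t ^ toℕ k ⊕ occurrences (toℕ k) xs · t ^ toℕ k)
      ≈⟨ sum-cong {m} (λ k → trans (sym (×-homo-+ (t ^ toℕ k) (occurrences (toℕ k) (x ∷ [])) (occurrences (toℕ k) xs)))
           (×-congˡ (≡.sym (occurrences-++ (toℕ k) (x ∷ []) xs)))) ⟩
    ∑[ k < m ] (occurrences (toℕ k) (x ∷ xs) · t ^ toℕ k) ∎

  twinPoly-τ : ∀ n t → twinPoly R n t ≈ ∑[ k ≤ n ] (τ n (toℕ k) · (t ^ toℕ k))
  twinPoly-τ n t = begin
    twinPoly R n t                   ≡⟨ twinPoly-powerSum n t ⟩
    powerSum t (map twin (DP n))     ≈⟨ powerSum-occurrences t (suc n) _ (twin-bounded n) ⟩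
    ∑[ k ≤ n ] (occurrences (toℕ k) (map twin (DP n)) · (t ^ toℕ k))
      ≈⟨ sum-cong {suc n} (λ k → ×-congˡ {t ^ toℕ k} (≡.sym (τ-occurrences n (toℕ k)))) ⟩
    ∑[ k ≤ n ] (τ n (toℕ k) · (t ^ toℕ k)) ∎

  -- Binomial transforms and the hypergeometric series

  -- transform u n d = Σⱼ (n C j) dⱼ uⁿ⁻ʲ
  transform : Carrier → ℕ → (ℕ → Carrier) → Carrier
  transform u zero    d = d 0
  transform u (suc n) d = u ⊛ transform u n d ⊕ transform u n (d ∘ suc)

  module _ (u : Carrier) where

    transform-cong : ∀ n {d e} → (∀ j → d j ≈ e j) → transform u n d ≈ transform u n e
    transform-cong zero    d≈e = d≈e 0
    transform-cong (suc n) d≈e = +-cong (*-congˡ (transform-cong n d≈e)) (transform-cong n (d≈e ∘ suc))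

    transform-⊕ : ∀ n d e → transform u n (λ j → d j ⊕ e j) ≈ transform u n d ⊕ transform u n e
    transform-⊕ zero    d e = refl
    transform-⊕ (suc n) d e = trans (+-cong (*-congˡ (transform-⊕ n d e)) (transform-⊕ n (d ∘ suc) (e ∘ suc)))
      (solve 5 (λ u x y z w → u :* (x :+ y) :+ (z :+ w) := (u :* x :+ z) :+ (u :* y :+ w)) refl u _ _ _ _)

    transform-zero : ∀ n → transform u n (λ _ → 0#) ≈ 0#
    transform-zero zero    = refl
    transform-zero (suc n) = trans (+-cong (trans (*-congˡ (transform-zero n)) (zeroʳ u)) (transform-zero n)) (+-identityʳ 0#)

  ballotR : ℕ → ℕ → Carrier
  ballotR h j = ballot j h · 1#

  -- The two flat letters together multiply by `1# ⊕ t`, as in the first summand of `transform`;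
  -- rise and fall add up to the ballot recursion, which is the shift of `d` in the second.
  powerSum-twinNumbers : ∀ t n h → powerSum t (twinNumbers n h) ≈ transform (1# ⊕ t) n (ballotR h)
  powerSum-twinNumbers t zero    zero    = refl
  powerSum-twinNumbers t zero    (suc h) = refl
  powerSum-twinNumbers t (suc n) h       = begin
    powerSum t (twinNumbers (suc n) h)
      ≡⟨ ≡.cong (powerSum t) (twinNumbers-suc n h) ⟩
    powerSum t (twinNumbers n (suc h) ++ map suc L ++ L ++ F)
      ≈⟨ trans (powerSum-++ t (twinNumbers n (suc h)) _) (+-congˡ (trans (powerSum-++ t (map suc L) _)
           (+-cong (powerSum-map-suc t L) (powerSum-++ t L F)))) ⟩
    powerSum t (twinNumbers n (suc h)) ⊕ (t ⊛ powerSum t L ⊕ (powerSum t L ⊕ powerSum t F))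
      ≈⟨ +-cong (powerSum-twinNumbers t n (suc h)) (+-cong (*-congˡ (powerSum-twinNumbers t n h))
           (+-cong (powerSum-twinNumbers t n h) (fall h))) ⟩
    T (ballotR (suc h)) ⊕ (t ⊛ T (ballotR h) ⊕ (T (ballotR h) ⊕ T (λ j → afterFall 0 (ballot j) h · 1#)))
      ≈⟨ +-congˡ (+-congˡ (+-congʳ (*-identityˡ (T (ballotR h))))) ⟨
    T (ballotR (suc h)) ⊕ (t ⊛ T (ballotR h) ⊕ (1# ⊛ T (ballotR h) ⊕ T (λ j → afterFall 0 (ballot j) h · 1#)))
      ≈⟨ solve 5 (λ o t x y z → x :+ (t :* y :+ (o :* y :+ z)) := (o :+ t) :* y :+ (x :+ z)) refl 1# t _ _ _ ⟩
    u ⊛ T (ballotR h) ⊕ (T (ballotR (suc h)) ⊕ T (λ j → afterFall 0 (ballot j) h · 1#))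
      ≈⟨ +-congˡ (trans
           (transform-cong u n (λ j → ×-homo-+ 1# (ballot j (suc h)) (afterFall 0 (ballot j) h)))
           (transform-⊕ u n (ballotR (suc h)) (λ j → afterFall 0 (ballot j) h · 1#))) ⟨
    u ⊛ T (ballotR h) ⊕ T (ballotR h ∘ suc) ∎
    where
    u = 1# ⊕ t
    T = transform u n
    L = twinNumbers n h
    F = afterFall [] (twinNumbers n) h
    fall : ∀ h → powerSum t (afterFall [] (twinNumbers n) h) ≈ T (λ j → afterFall 0 (ballot j) h · 1#)
    fall zero    = sym (transform-zero u n)
    fall (suc h) = powerSum-twinNumbers t n h

  twinPoly-transform : ∀ n t → twinPoly R (suc n) t ≈ transform (1# ⊕ t) n (ballotR 0)
  twinPoly-transform n t = begin
    twinPoly R (suc n) t                  ≡⟨ twinPoly-powerSum (suc n) t ⟩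
    powerSum t (map twin (DP (suc n)))    ≈⟨ powerSum-↭ t (map-twin-DP n) ⟩
    powerSum t (twinNumbers n 0)          ≈⟨ powerSum-twinNumbers t n 0 ⟩
    transform (1# ⊕ t) n (ballotR 0)      ∎

  -- `transform` with uⁿ taken out and `v` in the role of the inverse of u. The number `m` of terms
  -- is independent of `n`, because partial sums of every large enough length have to be compared.
  binomialSum : Carrier → ℕ → ℕ → (ℕ → Carrier) → Carrier
  binomialSum v m n d = ∑[ j < m ] ((n C toℕ j) · (d (toℕ j) ⊛ v ^ toℕ j))

  binomialSum-suc : ∀ v m n d →
    binomialSum v (suc m) (suc n) d ≈ binomialSum v (suc m) n d ⊕ v ⊛ binomialSum v m n (d ∘ suc)
  binomialSum-suc v m n d = begin
    head ⊕ ∑[ j < m ] ((suc n C suc (toℕ j)) · x (toℕ j))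
      ≈⟨ +-congˡ (trans (sum-cong {m} (λ j → trans (×-congˡ (≡.sym (nCk+nC[k+1]≡[n+1]C[k+1] n (toℕ j))))
           (×-homo-+ (x (toℕ j)) (n C toℕ j) (n C suc (toℕ j))))) (∑-distrib-+ {m} _ _)) ⟩
    head ⊕ (∑[ j < m ] ((n C toℕ j) · x (toℕ j)) ⊕ ∑[ j < m ] ((n C suc (toℕ j)) · x (toℕ j)))
      ≈⟨ solve 3 (λ x y z → x :+ (y :+ z) := (x :+ z) :+ y) refl head _ _ ⟩
    binomialSum v (suc m) n d ⊕ ∑[ j < m ] ((n C toℕ j) · x (toℕ j))
      ≈⟨ +-congˡ (sum-cong {m} (λ j → trans (×-congʳ (n C toℕ j) (x-suc (toℕ j)))
           (sym (×-comm-* (n C toℕ j) v _)))) ⟩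
    binomialSum v (suc m) n d ⊕ ∑[ j < m ] (v ⊛ ((n C toℕ j) · (d (suc (toℕ j)) ⊛ v ^ toℕ j)))
      ≈⟨ +-congˡ (*-distribˡ-sum {m} v _) ⟨
    binomialSum v (suc m) n d ⊕ v ⊛ binomialSum v m n (d ∘ suc) ∎
    where
    head = 1 · (d 0 ⊛ 1#)
    x : ℕ → Carrier
    x j = d (suc j) ⊛ v ^ suc j
    x-suc : ∀ j → x j ≈ v ⊛ (d (suc j) ⊛ v ^ j)
    x-suc j = solve 3 (λ d v p → d :* (v :* p) := v :* (d :* p)) refl (d (suc j)) v (v ^ j)

  module _ {u v : Carrier} (uv≈1 : u ⊛ v ≈ 1#) where

    -- With more than n terms no nonzero binomial coefficient is cut off. In Pascal's rule the
    -- shifted part loses one term and gains a factor `v`, which cancels the additional `u`.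
    transform-binomialSum : ∀ n m d → n < m → u ^ n ⊛ binomialSum v m n d ≈ transform u n d
    transform-binomialSum zero (suc m) d _ = begin
      1# ⊛ ((d 0 ⊛ 1# ⊕ 0#) ⊕ ∑[ j < m ] (0 · (d (suc (toℕ j)) ⊛ v ^ suc (toℕ j))))
        ≈⟨ trans (*-identityˡ _) (+-congˡ (sum-zero {m} (λ _ → refl))) ⟩
      (d 0 ⊛ 1# ⊕ 0#) ⊕ 0#
        ≈⟨ trans (+-identityʳ _) (trans (+-identityʳ _) (*-identityʳ (d 0))) ⟩
      d 0 ∎
    transform-binomialSum (suc n) (suc m) d (s≤s n<m) = begin
      (u ⊛ u ^ n) ⊛ binomialSum v (suc m) (suc n) d
        ≈⟨ *-congˡ (binomialSum-suc v m n d) ⟩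
      (u ⊛ u ^ n) ⊛ (binomialSum v (suc m) n d ⊕ v ⊛ binomialSum v m n (d ∘ suc))
        ≈⟨ solve 5 (λ u p x v y → (u :* p) :* (x :+ v :* y) := u :* (p :* x) :+ (u :* v) :* (p :* y)) refl u (u ^ n) _ v _ ⟩
      u ⊛ (u ^ n ⊛ binomialSum v (suc m) n d) ⊕ (u ⊛ v) ⊛ (u ^ n ⊛ binomialSum v m n (d ∘ suc))
        ≈⟨ +-cong (*-congˡ (transform-binomialSum n (suc m) d (ℕ.m≤n⇒m≤1+n n<m)))
             (*-cong uv≈1 (transform-binomialSum n m (d ∘ suc) n<m)) ⟩
      u ⊛ transform u n d ⊕ 1# ⊛ transform u n (d ∘ suc)
        ≈⟨ +-congˡ (*-identityˡ _) ⟩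
      u ⊛ transform u n d ⊕ transform u n (d ∘ suc) ∎

    ^-inverse : ∀ n → u ^ n ⊛ v ^ n ≈ 1#
    ^-inverse n = trans (sym (^-distrib-* u v n)) (trans (^-congˡ n uv≈1) (one-^ n))
      where
      one-^ : ∀ n → 1# ^ n ≈ 1#
      one-^ zero    = refl
      one-^ (suc n) = trans (*-identityˡ _) (one-^ n)

  -- The hypergeometric series lists only the paths with an even number of non-flat steps, so m of
  -- its terms match 2m terms of the binomial sum.
  sum-even : ∀ m (f : ℕ → Carrier) → (∀ i → f (suc (i ℕ.* 2)) ≈ 0#) →
             ∑[ i < m ] f (toℕ i ℕ.* 2) ≈ ∑[ j < m ℕ.* 2 ] f (toℕ j)
  sum-even zero    f odd = refl
  sum-even (suc m) f odd = +-congˡ (begin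
    ∑[ i < m ] f (suc (suc (toℕ i ℕ.* 2)))               ≈⟨ sum-even m (λ j → f (suc (suc j))) (odd ∘ suc) ⟩
    ∑[ j < m ℕ.* 2 ] f (suc (suc (toℕ j)))               ≈⟨ +-identityˡ _ ⟨
    0# ⊕ ∑[ j < m ℕ.* 2 ] f (suc (suc (toℕ j)))          ≈⟨ +-congʳ (odd 0) ⟨
    f 1 ⊕ ∑[ j < m ℕ.* 2 ] f (suc (suc (toℕ j)))         ∎)

  ·-^ : ∀ k x i → (k · x) ^ i ≈ (k ℕ.^ i) · (x ^ i)
  ·-^ k x zero    = sym (×-homo-1 1#)
  ·-^ k x (suc i) = begin
    (k · x) ⊛ (k · x) ^ i               ≈⟨ *-congˡ (·-^ k x i) ⟩
    (k · x) ⊛ ((k ℕ.^ i) · x ^ i)       ≈⟨ ×-assoc-* k x _ ⟩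
    k · (x ⊛ ((k ℕ.^ i) · x ^ i))       ≈⟨ ×-congʳ k (×-comm-* (k ℕ.^ i) x (x ^ i)) ⟩
    k · ((k ℕ.^ i) · (x ⊛ x ^ i))       ≈⟨ ×-assocˡ (x ⊛ x ^ i) k (k ℕ.^ i) ⟩
    (k ℕ.* k ℕ.^ i) · (x ⊛ x ^ i)       ∎

  module _ {φ : ℚ → Carrier} (φ-hom : IsRingHomomorphism ℚ.+-*-rawRing rawRing φ) where
    open IsRingHomomorphism φ-hom using (+-homo; *-homo; 0#-homo; 1#-homo)

    φ-ℕ→ℚ : ∀ k → φ (ℕ→ℚ k) ≈ k · 1#
    φ-ℕ→ℚ zero    = 0#-homo
    φ-ℕ→ℚ (suc k) = begin
      φ (ℕ→ℚ (suc k))        ≡⟨ ≡.cong φ (ℕ→ℚ-+ 1 k) ⟩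
      φ (ℚ.1ℚ ℚ.+ ℕ→ℚ k)     ≈⟨ +-homo ℚ.1ℚ (ℕ→ℚ k) ⟩
      φ ℚ.1ℚ ⊕ φ (ℕ→ℚ k)     ≈⟨ +-cong 1#-homo (φ-ℕ→ℚ k) ⟩
      1# ⊕ k · 1#            ∎

    -- The factor 4ⁱ of the argument is moved inside `φ`, where it turns the coefficient into a
    -- natural number; on these the value of `φ` is known.
    ₂F₁-term : ∀ n v i → let a = ℚ.- ((+ suc n ℤ.- + 1) ℚ./ 2) ; b = (+ 2 ℤ.- + suc n) ℚ./ 2 in
      φ (₂F₁-coeff a b 2ℚ 2-admissible i) ⊛ (4 · (v ^ 2)) ^ i ≈
      (n C (i ℕ.* 2)) · (ballotR 0 (i ℕ.* 2) ⊛ v ^ (i ℕ.* 2))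
    ₂F₁-term n v i = begin
      φ c ⊛ (4 · (v ^ 2)) ^ i                          ≈⟨ *-congˡ (·-^ 4 (v ^ 2) i) ⟩
      φ c ⊛ ((4 ℕ.^ i) · (v ^ 2) ^ i)                  ≈⟨ *-congˡ (×-congʳ (4 ℕ.^ i) v^2i) ⟩
      φ c ⊛ ((4 ℕ.^ i) · w)                            ≈⟨ *-congˡ (×-congʳ (4 ℕ.^ i) (*-identityˡ w)) ⟨
      φ c ⊛ ((4 ℕ.^ i) · (1# ⊛ w))                     ≈⟨ *-congˡ (×-assoc-* (4 ℕ.^ i) 1# w) ⟨
      φ c ⊛ (((4 ℕ.^ i) · 1#) ⊛ w)                     ≈⟨ *-assoc (φ c) _ w ⟨
      (φ c ⊛ ((4 ℕ.^ i) · 1#)) ⊛ w                     ≈⟨ *-congʳ (*-congˡ (φ-ℕ→ℚ (4 ℕ.^ i))) ⟨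
      (φ c ⊛ φ (ℕ→ℚ (4 ℕ.^ i))) ⊛ w                    ≈⟨ *-congʳ (*-homo c (ℕ→ℚ (4 ℕ.^ i))) ⟨
      φ (c ℚ.* ℕ→ℚ (4 ℕ.^ i)) ⊛ w
        ≡⟨ ≡.cong (λ q → φ q ⊛ w) (₂F₁-coeff-ballot n (first-parameter n) (second-parameter n) i) ⟩
      φ (ℕ→ℚ (k ℕ.* ballot (i ℕ.* 2) 0)) ⊛ w           ≈⟨ *-congʳ (φ-ℕ→ℚ (k ℕ.* ballot (i ℕ.* 2) 0)) ⟩
      ((k ℕ.* ballot (i ℕ.* 2) 0) · 1#) ⊛ w            ≈⟨ *-congʳ (×-assocˡ 1# k (ballot (i ℕ.* 2) 0)) ⟨
      (k · ballotR 0 (i ℕ.* 2)) ⊛ w                    ≈⟨ ×-assoc-* k (ballotR 0 (i ℕ.* 2)) w ⟩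
      k · (ballotR 0 (i ℕ.* 2) ⊛ w)                    ∎
      where
      c = ₂F₁-coeff (ℚ.- ((+ suc n ℤ.- + 1) ℚ./ 2)) ((+ 2 ℤ.- + suc n) ℚ./ 2) 2ℚ 2-admissible i
      k = n C (i ℕ.* 2)
      w = v ^ (i ℕ.* 2)
      v^2i : (v ^ 2) ^ i ≈ w
      v^2i = trans (^-assocʳ v 2 i) (reflexive (≡.cong (v ^_) (ℕ.*-comm 2 i)))

    twinPoly-₂F₁ : ∀ n → 1 ≤ n → (t [1+t]⁻¹ : Carrier) → (1# ⊕ t) ⊛ [1+t]⁻¹ ≈ 1# →
      ∃ λ F →
        Is₂F₁ R φ (ℚ.- ((+ n ℤ.- + 1) ℚ./ 2)) ((+ 2 ℤ.- + n) ℚ./ 2) 2ℚ 2-admissible (4 · ([1+t]⁻¹ ^ 2)) F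
        × twinPoly R n t ≈ ((1# ⊕ t) ^ (n ∸ 1)) ⊛ F
    -- Since `v` inverts `1# ⊕ t`, the required equation forces this value of F. The series is
    -- complete from `suc n` terms on, as these cover all indices up to n after doubling.
    twinPoly-₂F₁ (suc n) _ t v uv≈1 = v ^ n ⊛ T , (suc n , converges) , (begin
      twinPoly R (suc n) t     ≈⟨ twinPoly-transform n t ⟩
      T                        ≈⟨ *-identityˡ T ⟨
      1# ⊛ T                   ≈⟨ *-congʳ (^-inverse uv≈1 n) ⟨
      (u ^ n ⊛ v ^ n) ⊛ T      ≈⟨ *-assoc (u ^ n) (v ^ n) T ⟩
      u ^ n ⊛ (v ^ n ⊛ T)      ∎)
      where
      u = 1# ⊕ t
      T = transform u n (ballotR 0)
      term : ℕ → Carrier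
      term j = (n C j) · (ballotR 0 j ⊛ v ^ j)
      term-odd : ∀ i → term (suc (i ℕ.* 2)) ≈ 0#
      term-odd i = begin
        k · ((ballot (suc (i ℕ.* 2)) 0 · 1#) ⊛ w)   ≡⟨ ≡.cong (λ b → k · ((b · 1#) ⊛ w))
          (ballot-odd i (suc (i ℕ.* 2)) 0 (ℕ.+-identityʳ _)) ⟩
        k · (0# ⊛ w)                                ≈⟨ ×-congʳ k (zeroˡ w) ⟩
        k · 0#                                      ≈⟨ ×-congʳ k (zeroʳ 0#) ⟨
        k · (0# ⊛ 0#)                               ≈⟨ ×-comm-* k 0# 0# ⟨
        0# ⊛ (k · 0#)                               ≈⟨ zeroˡ _ ⟩
        0#                                          ∎
        where
        k = n C suc (i ℕ.* 2)
        w = v ^ suc (i ℕ.* 2)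
      converges : ∀ m → m ℕ.≥ suc n →
        ₂F₁-partialSum R φ (ℚ.- ((+ suc n ℤ.- + 1) ℚ./ 2)) ((+ 2 ℤ.- + suc n) ℚ./ 2) 2ℚ 2-admissible (4 · (v ^ 2)) m ≈ v ^ n ⊛ T
      converges m m>n = begin
        _                                                ≈⟨ sum-cong {m} (λ i → ₂F₁-term n v (toℕ i)) ⟩
        ∑[ i < m ] term (toℕ i ℕ.* 2)                    ≈⟨ sum-even m term term-odd ⟩
        S                                                ≈⟨ *-identityˡ S ⟨
        1# ⊛ S                                           ≈⟨ *-congʳ (^-inverse uv≈1 n) ⟨
        (u ^ n ⊛ v ^ n) ⊛ S                              ≈⟨ solve 3 (λ x y z → (x :* y) :* z := y :* (x :* z)) refl (u ^ n) (v ^ n) S ⟩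
        v ^ n ⊛ (u ^ n ⊛ S)                              ≈⟨ *-congˡ (transform-binomialSum uv≈1 n (m ℕ.* 2) (ballotR 0)
          (ℕ.≤-trans m>n (ℕ.m≤m*n m 2))) ⟩
        v ^ n ⊛ T                                        ∎
        where
        S = binomialSum v (m ℕ.* 2) n (ballotR 0)

proposition6p3 : ∀ {r ℓ} →
    (∀ n k → k ≤ suc n → τ (suc n) k ≡ (n C k) * M (n ∸ k))
    × (∀ m → 1 ≤ m → ∀ k → k < m → τ m k ≡ A091869 m k)
    × ((R : CommutativeRing r ℓ) → let open RingNotation R in
    (∀ n (t : Carrier) → twinPoly R n t ≈ ∑[ k ≤ n ] (τ n (toℕ k) · (t ^ toℕ k)))
    × ((φ : ℚ → Carrier) → IsRingHomomorphism ℚ.+-*-rawRing rawRing φ →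
    ∀ n → 1 ≤ n → (t [1+t]⁻¹ : Carrier) → (1# ⊕ t) ⊛ [1+t]⁻¹ ≈ 1# →
    ∃ λ F →
    Is₂F₁ R φ (ℚ.- ((+ n ℤ.- + 1) ℚ./ 2)) ((+ 2 ℤ.- + n) ℚ./ 2) 2ℚ 2-admissible (4 · ([1+t]⁻¹ ^ 2)) F
    × twinPoly R n t ≈ ((1# ⊕ t) ^ (n ∸ 1)) ⊛ F))
proposition6p3 =
  (λ n k _ → τ-closed n k) ,
  (λ { (suc m) _ k _ → τ-closed m k }) ,
  (λ R → twinPoly-τ R , (λ φ φ-hom → twinPoly-₂F₁ R φ-hom))
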